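{- There exists $c>0$ satisfying the following. Let $\varepsilon\in(0,1)$ and $n\in\mathbb{N}$. For every local property $\mathcal{P}$ of sequences $f:[n]\to\mathbb{R}$ and every $t\le\frac{c\,\varepsilon^2n}{\log^2(\varepsilon n)}$, there exists an $\varepsilon$-tester for $\mathcal{P}$ with batch size $b=2$ that works in the presence of a $t$-online erasure (or corruption) budget-managing adversary and makes $O\left(\frac{\log(\varepsilon n)}{\varepsilon}\right)$ queries. In the case of erasures, the tester has one-sided error.
   Context: $\log$ is base 2; $[n]=\{1,\dots,n\}$; $t$ is a positive real. A property $\mathcal{P}$ of sequences $f:[n]\to\mathbb{R}$ is local if there is a family $\mathcal{F}\subseteq\mathbb{R}^2$ of forbidden pairs such that $f\in\mathcal{P}$ iff $(f(i),f(i+1))\notin\mathcal{F}$ for all $i\in[n-1]$. Online model with batches. Access to the input $f$ is via a sequence of oracles $\mathcal{O}_1,\mathcal{O}_2,\dots$ with $\mathcal{O}_1=f$; with batch size $b$, oracle $\mathcal{O}_i$ answers the $i$-th batch of $b$ queries. After each batch the adversary chooses the next oracle; its strategy may depend on the input, the tester's description, and all queries made so far, but not on the tester's future coin tosses. Let $\mathrm{Dist}$ denote Hamming distance (number of points with different answers). A $t$-online budget-managing adversary must satisfy $\mathrm{Dist}(\mathcal{O}_1,\mathcal{O}_{i+1})\le i\cdot t$ for all $i\in\mathbb{N}$. An erasure adversary must satisfy $\mathcal{O}_{i+1}(x)\in\{\mathcal{O}_i(x),\perp\}$ for all $x$ ($\perp$ is the erasure symbol); a corruption adversary may change values arbitrarily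 within the range. Query complexity counts the total number of individual queries. $f$ is $\varepsilon$-far from $\mathcal{P}$ if at least an $\varepsilon$ fraction of the values of $f$ must be changed to obtain a sequence in $\mathcal{P}$. An (online) $\varepsilon$-tester for $\mathcal{P}$ working in the presence of a given type of adversary is a randomized algorithm that, for every adversarial strategy of that type, accepts with probability at least $2/3$ if $f\in\mathcal{P}$ and rejects with probability at least $2/3$ if $f$ is $\varepsilon$-far from $\mathcal{P}$. It has one-sided error if it always accepts every $f\in\mathcal{P}$.
   Formalization: In both bounds log(εn) is read as max(1, log(εn)), the same for εn ≥ 2; literally the claim is undefined at εn = 1 and false just above it (n = 2, P = {(0,0)}, ε slightly above 1/2 would allow no queries). -}

module Defs where

open import Level using (0ℓ)
open import Algebra.Bundles using (CommutativeRing; Semiring)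
open import Algebra.Structures using (IsCommutativeRing)
import Algebra.Construct.NaturalChoice.Max as Max
import Algebra.Definitions.RawSemiring as RawSemiringDefs
open import Axiom.ExcludedMiddle using (ExcludedMiddle)
open import Data.Bool using (Bool; true; false)
import Data.Bool.Properties as Bool
open import Data.Fin using (Fin; toℕ)
open import Data.Integer using (+_)
open import Data.List using (List; []; _∷_; length; filter; allFin)
open import Data.Maybe using (Maybe; just; nothing)
open import Data.Nat as ℕ using (ℕ; suc; NonZero)
open import Data.Product using (Σ; ∃; ∃-syntax; _×_; _,_)
open import Data.Rational.Unnormalised as ℚᵘ using (ℚᵘ)
open import Data.Sum using (_⊎_)
open import Data.Vec as Vec using (Vec)
open import Function.Bundles using (_⇔_)
import Relation.Binary.Construct.NonStrictToStrict as ToStrict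
open import Relation.Binary.Bundles using (TotalOrder)
open import Relation.Binary.Structures using (IsTotalOrder)
open import Relation.Binary.PropositionalEquality using (_≡_; _≢_)
open import Relation.Nullary using (¬_; yes; no)
open import Relation.Unary using (Pred; _∈_; _∉_)

-- The real numbers, given by their axioms: the (unique up to isomorphism)
-- Dedekind-complete ordered field.  The value of 0# ⁻¹ is left unspecified.
record CompleteOrderedField : Set₁ where
  infixl 6 _+_
  infixl 7 _*_
  infix  8 -_
  infix  9 _⁻¹
  infix  4 _≤_
  field
    ℝ                 : Set
    _+_ _*_           : ℝ → ℝ → ℝ
    -_ _⁻¹            : ℝ → ℝ
    0# 1#             : ℝ
    isCommutativeRing : IsCommutativeRing _≡_ _+_ _*_ -_ 0# 1#
    0≢1               : 0# ≢ 1#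
    *-inverseʳ        : ∀ x → x ≢ 0# → x * x ⁻¹ ≡ 1#
    _≤_               : ℝ → ℝ → Set
    isTotalOrder      : IsTotalOrder _≡_ _≤_
    +-monoˡ-≤         : ∀ z {x y} → x ≤ y → x + z ≤ y + z
    *-nonneg          : ∀ {x y} → 0# ≤ x → 0# ≤ y → 0# ≤ x * y

  IsUpperBound : Pred ℝ 0ℓ → ℝ → Set
  IsUpperBound S u = ∀ x → x ∈ S → x ≤ u

  IsSupremum : Pred ℝ 0ℓ → ℝ → Set
  IsSupremum S s = IsUpperBound S s × (∀ u → IsUpperBound S u → s ≤ u)

  field
    complete : ∀ S → ∃ S → ∃ (IsUpperBound S) → ∃ (IsSupremum S)

  commutativeRing : CommutativeRing 0ℓ 0ℓ
  commutativeRing = record { isCommutativeRing = isCommutativeRing }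

  totalOrder : TotalOrder 0ℓ 0ℓ 0ℓ
  totalOrder = record { isTotalOrder = isTotalOrder }

  open ToStrict (_≡_ {A = ℝ}) _≤_ public using (_<_)
  open Max totalOrder public using (_⊔_)
  open RawSemiringDefs (Semiring.rawSemiring (CommutativeRing.semiring commutativeRing)) public
    using (_^_) renaming (_×_ to _·_)

  infixl 6 _-_
  _-_ : ℝ → ℝ → ℝ
  x - y = x + (- y)

  infixl 7 _/_
  _/_ : ℝ → ℝ → ℝ
  x / y = x * y ⁻¹

  fromℕ : ℕ → ℝ
  fromℕ k = k · 1#

module Log (em : ExcludedMiddle 0ℓ) (R : CompleteOrderedField) where
  open CompleteOrderedField R

  -- By `complete`, the value 0# is only used when S is empty or unbounded above.
  sup : Pred ℝ 0ℓ → ℝ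
  sup S with em {∃ (IsSupremum S)}
  ... | yes (s , _) = s
  ... | no  _       = 0#

  -- For x > 0, log₂ x is the supremum of the rationals r with 2 ^ r ≤ x.
  -- Here r = (a - b) / (1 + q) with a, b, q natural, so that 2 ^ r ≤ x
  -- reads 2 ^ a ≤ 2 ^ b * x ^ (1 + q).
  log₂ : ℝ → ℝ
  log₂ x = sup λ r → ∃[ a ] ∃[ b ] ∃[ q ]
    r ≡ (fromℕ a - fromℕ b) / fromℕ (suc q) ×
    fromℕ 2 ^ a ≤ fromℕ 2 ^ b * x ^ suc q

  -- The logarithm as it occurs in asymptotic bounds, where log x would
  -- otherwise vanish or be negative.  It equals log₂ x whenever x ≥ 2.
  log⁺ : ℝ → ℝ
  log⁺ x = 1# ⊔ log₂ x

module Online (em : ExcludedMiddle 0ℓ) (R : CompleteOrderedField) where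
  open CompleteOrderedField R

  Seq : ℕ → Set
  Seq n = Fin n → ℝ

  IsLocal : ∀ {n} → Pred (Seq n) 0ℓ → Set₁
  IsLocal P = Σ (Pred (ℝ × ℝ) 0ℓ) λ F →
    ∀ f → f ∈ P ⇔ (∀ i j → toℕ j ≡ suc (toℕ i) → (f i , f j) ∉ F)

  Dist : ∀ {A : Set} {n} → (Fin n → A) → (Fin n → A) → ℕ
  Dist {n = n} f g = length (filter (λ x → em {f x ≢ g x}) (allFin n))

  IsFar : ∀ {n} → ℝ → Pred (Seq n) 0ℓ → Pred (Seq n) 0ℓ
  IsFar {n} ε P f = ∀ g → g ∈ P → ε * fromℕ n ≤ fromℕ (Dist f g)

  -- `nothing` is the erasure symbol ⊥.
  Answer : Set
  Answer = Maybe ℝ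

  Batch : ℕ → ℕ → Set
  Batch n b = Vec (Fin n) b

  -- What a tester does once its coins are fixed.
  data Strategy (n b : ℕ) : Set where
    output : (accept : Bool) → Strategy n b
    ask    : Batch n b → (Vec Answer b → Strategy n b) → Strategy n b

  -- A bound on the number of individual queries, whatever the answers.
  data _MakesAtMost_ {n b : ℕ} : Strategy n b → ℕ → Set where
    output : ∀ {v q} → output v MakesAtMost q
    ask    : ∀ {xs k q} → (∀ as → k as MakesAtMost q) →
             ask xs k MakesAtMost (b ℕ.+ q)

  -- The coin tosses are a uniformly random seed.  The adversary never sees the
  -- seed, only the queries it gives rise to.
  record Tester (n b : ℕ) : Set where
    field
      seeds       : ℕ
      {{nonZero}} : NonZero seeds
      strategy    : Fin seeds → Strategy n b

  open Tester

  -- The oracle in force after the given batches (most recent first) have been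
  -- answered; the oracle after i batches is 𝒪ᵢ₊₁.
  Adversary : ℕ → ℕ → Set
  Adversary n b = List (Batch n b) → Fin n → Answer

  data Kind : Set where
    erasure corruption : Kind

  Manipulates : ∀ {n b} → Kind → Pred (Adversary n b) 0ℓ
  Manipulates erasure 𝒪 =
    ∀ xs h x → 𝒪 (xs ∷ h) x ≡ 𝒪 h x ⊎ 𝒪 (xs ∷ h) x ≡ nothing
  Manipulates corruption 𝒪 =
    ∀ h x → ∃[ v ] 𝒪 h x ≡ just v

  record IsBudgetManaging {n b} (κ : Kind) (t : ℝ) (f : Seq n)
                          (𝒪 : Adversary n b) : Set where
    field
      initial     : ∀ x → 𝒪 [] x ≡ just (f x)
      budget      : ∀ h → fromℕ (Dist (𝒪 []) (𝒪 h)) ≤ fromℕ (length h) * t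
      manipulates : Manipulates κ 𝒪

  execute : ∀ {n b} → Strategy n b → Adversary n b → List (Batch n b) → Bool
  execute (output v) 𝒪 h = v
  execute (ask xs k) 𝒪 h = execute (k (Vec.map (𝒪 h) xs)) 𝒪 (xs ∷ h)

  result : ∀ {n b} (T : Tester n b) → Adversary n b → Fin (seeds T) → Bool
  result T 𝒪 s = execute (strategy T s) 𝒪 []

  Pr : ∀ {n b} → Tester n b → Adversary n b → Bool → ℚᵘ
  Pr T 𝒪 v =
    + length (filter (λ s → result T 𝒪 s Bool.≟ v) (allFin (seeds T)))
      ℚᵘ./ seeds T

  2/3 : ℚᵘ
  2/3 = + 2 ℚᵘ./ 3

  IsTester : ∀ {n b} → ℝ → Pred (Seq n) 0ℓ → Kind → ℝ → Tester n b → Set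
  IsTester ε P κ t T = ∀ f 𝒪 → IsBudgetManaging κ t f 𝒪 →
    (f ∈ P → 2/3 ℚᵘ.≤ Pr T 𝒪 true) ×
    (f ∈ IsFar ε P → 2/3 ℚᵘ.≤ Pr T 𝒪 false)

  HasOneSidedError : ∀ {n b} → Pred (Seq n) 0ℓ → Kind → ℝ → Tester n b → Set
  HasOneSidedError P κ t T = ∀ f 𝒪 → IsBudgetManaging κ t f 𝒪 →
    f ∈ P → ∀ s → result T 𝒪 s ≡ true

  QueryComplexity≤ : ∀ {n b} → ℝ → Tester n b → Set
  QueryComplexity≤ B T =
    ∃[ q ] fromℕ q ≤ B × (∀ s → strategy T s MakesAtMost q)

-- Call a pair (x, x + 2^k) bad if no member of P agrees with f at both
-- positions.  Locality lets two members of P that agree at a position be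
-- spliced there, so a pair that is not bad can be repaired by bisection:
-- where both halves are not bad, repair them separately and splice; otherwise
-- rewrite the whole interval, at a cost charged to the bad half.  Starting the
-- bisection from a randomly shifted grid of mesh 2^K = Θ(ε n) shows that if f is
-- ε-far, then the bad pairs at the scales k ≤ K number Ω(ε n) in total.  Hence
-- one batch, querying x and x + 2^k for uniform x and k ≤ K, hits a bad pair
-- with probability Ω(ε / log (ε n)), and O(log (ε n) / ε) batches suffice.
-- Either query of a batch takes each value with probability at most 2 / n and
-- is independent of the past, so by the bound on t a union bound shows that
-- with probability at least 5/6 no query ever meets a manipulated value.

module Submission where

open import Defs
open import Level using (0ℓ)
open import Algebra.Bundles using (CommutativeRing)
import Algebra.Construct.NaturalChoice.Max as Max
import Algebra.Properties.Ring as RingProperties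
import Algebra.Properties.Semiring.Exp as SemiringExp
import Algebra.Properties.Semiring.Mult as SemiringMult
import Algebra.Solver.Ring.NaturalCoefficients.Default as SemiringSolver
open import Axiom.ExcludedMiddle using (ExcludedMiddle)
open import Data.Bool using (Bool; true; false; if_then_else_; not)
import Data.Bool.Properties as Bool
open import Data.Fin as Fin using (Fin; toℕ; fromℕ<; combine; quotient; remainder; remQuot; _↑ˡ_; _↑ʳ_)
import Data.Fin.Properties as Fin
import Data.Integer as ℤ
import Data.Integer.Properties as ℤ
open import Data.List using (List; []; _∷_; length; filter; tabulate)
open import Data.Maybe using (just; nothing)
open import Data.Maybe.Properties using (just-injective)
open import Data.Nat as ℕ using (ℕ; zero; suc; NonZero; z≤n; s≤s)
import Data.Nat.DivMod as ℕ
import Data.Nat.Properties as ℕ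
open import Data.Product using (Σ; ∃; ∃-syntax; _×_; _,_; proj₁; proj₂; uncurry)
import Data.Rational.Unnormalised as ℚᵘ
open import Data.Sum as Sum using (_⊎_; inj₁; inj₂)
open import Data.Vec as Vec using (Vec; []; _∷_; lookup)
open import Data.Vec.Properties using (lookup-map)
open import Function using (_∘_; id)
open import Function.Bundles using (module Equivalence)
open import Relation.Binary.Bundles using (TotalOrder)
open import Relation.Binary.PropositionalEquality
  using (_≡_; _≢_; refl; sym; trans; cong; cong₂; subst; subst₂; module ≡-Reasoning)
import Relation.Binary.Reasoning.PartialOrder as PartialOrderReasoning
open import Relation.Nullary using (¬_; Dec; yes; no; does; contradiction)
open import Relation.Unary using (Pred; Decidable; _∈_)

module Combinatorics where
  open import Data.Nat
  open import Data.Nat.Properties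
  open import Data.Nat.Solver using (module +-*-Solver)
  open import Algebra.Properties.Semiring.Sum +-*-semiring
    using (sum; sum-cong-≗; ∑-distrib-+; ∑-comm; *-distribˡ-sum; *-distribʳ-sum)

  -- Indicators and finite sums of natural numbers

  ind : {A : Set} → Dec A → ℕ
  ind (yes _) = 1
  ind (no _)  = 0

  ind-mono : {A B : Set} (d : Dec A) (e : Dec B) → (A → B) → ind d ≤ ind e
  ind-mono (yes _) (yes _) _ = ≤-refl
  ind-mono (yes a) (no ¬b) f = contradiction (f a) ¬b
  ind-mono (no _)  _       _ = z≤n

  ind-≤1 : {A : Set} (d : Dec A) → ind d ≤ 1
  ind-≤1 (yes _) = ≤-refl
  ind-≤1 (no _)  = z≤n

  ind-true : {A : Set} (d : Dec A) → A → ind d ≡ 1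
  ind-true (yes _) _ = refl
  ind-true (no ¬a) a = contradiction a ¬a

  ind-false : {A : Set} (d : Dec A) → ¬ A → ind d ≡ 0
  ind-false (yes a) ¬a = contradiction a ¬a
  ind-false (no _)  _  = refl

  ind-⊎ : {A B C : Set} (d : Dec A) (e : Dec B) (e′ : Dec C) → (A → B ⊎ C) → ind d ≤ ind e + ind e′
  ind-⊎ (no _)  _       _        _ = z≤n
  ind-⊎ (yes _) (yes _) _        _ = s≤s z≤n
  ind-⊎ (yes _) (no _)  (yes _)  _ = ≤-refl
  ind-⊎ (yes a) (no ¬b) (no ¬c)  f with f a
  ... | inj₁ b = contradiction b ¬b
  ... | inj₂ c = contradiction c ¬c

  ind-disjoint : {A B : Set} (d : Dec A) (e : Dec B) → (A → ¬ B) → ind d + ind e ≤ 1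
  ind-disjoint (yes a) (yes b) f = contradiction b (f a)
  ind-disjoint (yes _) (no _)  _ = ≤-refl
  ind-disjoint (no _)  e       _ = ind-≤1 e

  length-filter-tabulate : ∀ {n} {A : Set} {P : Pred A 0ℓ} (P? : Decidable P) (f : Fin n → A) →
    length (filter P? (tabulate f)) ≡ sum (λ i → ind (P? (f i)))
  length-filter-tabulate {zero}  P? f = refl
  length-filter-tabulate {suc n} P? f with P? (f Fin.zero)
  ... | yes _ = cong suc (length-filter-tabulate P? (f ∘ Fin.suc))
  ... | no  _ = length-filter-tabulate P? (f ∘ Fin.suc)

  sum-mono-≤ : ∀ {n} {f g : Fin n → ℕ} → (∀ i → f i ≤ g i) → sum f ≤ sum g
  sum-mono-≤ {zero}  f≤g = z≤n
  sum-mono-≤ {suc n} f≤g = +-mono-≤ (f≤g Fin.zero) (sum-mono-≤ (f≤g ∘ Fin.suc))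

  sum-const : ∀ n c → sum {n} (λ _ → c) ≡ n * c
  sum-const zero    c = refl
  sum-const (suc n) c = cong (c +_) (sum-const n c)

  sum-split : ∀ m {n} (f : Fin (m + n) → ℕ) →
    sum f ≡ sum (λ i → f (i ↑ˡ n)) + sum (λ j → f (m ↑ʳ j))
  sum-split zero    f = refl
  sum-split (suc m) f =
    trans (cong (f Fin.zero +_) (sum-split m (f ∘ Fin.suc))) (sym (+-assoc (f Fin.zero) _ _))

  sum-combine : ∀ m {n} (f : Fin (m * n) → ℕ) →
    sum f ≡ sum (λ i → sum (λ j → f (combine {m} {n} i j)))
  sum-combine zero        f = refl
  sum-combine (suc m) {n} f =
    trans (sum-split n f) (cong (sum (λ j → f (j ↑ˡ m * n)) +_) (sum-combine m (λ i → f (n ↑ʳ i))))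

  rangeSum : ℕ → (ℕ → ℕ) → ℕ
  rangeSum X h = sum {X} (h ∘ toℕ)

  rangeSum-mono : ∀ X {g h : ℕ → ℕ} → (∀ x → x < X → g x ≤ h x) → rangeSum X g ≤ rangeSum X h
  rangeSum-mono X g≤h = sum-mono-≤ λ i → g≤h (toℕ i) (Fin.toℕ<n i)

  rangeSum-cong : ∀ X {g h : ℕ → ℕ} → (∀ x → g x ≡ h x) → rangeSum X g ≡ rangeSum X h
  rangeSum-cong X g≗h = sum-cong-≗ {X} (g≗h ∘ toℕ)

  rangeSum-+ : ∀ X Y h → rangeSum (X + Y) h ≡ rangeSum X h + rangeSum Y (λ y → h (X + y))
  rangeSum-+ zero    Y h = refl
  rangeSum-+ (suc X) Y h =
    trans (cong (h 0 +_) (rangeSum-+ X Y (h ∘ suc))) (sym (+-assoc (h 0) _ _))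

  rangeSum-suc : ∀ X h → rangeSum (suc X) h ≡ rangeSum X h + h X
  rangeSum-suc X h = begin
    rangeSum (suc X) h                             ≡⟨ cong (λ z → rangeSum z h) (+-comm 1 X) ⟩
    rangeSum (X + 1) h                             ≡⟨ rangeSum-+ X 1 h ⟩
    rangeSum X h + (h (X + 0) + 0)                 ≡⟨ cong (rangeSum X h +_) (+-identityʳ _) ⟩
    rangeSum X h + h (X + 0)                       ≡⟨ cong (λ z → rangeSum X h + h z) (+-identityʳ X) ⟩
    rangeSum X h + h X                             ∎
    where open ≡-Reasoning

  rangeSum-monoˡ : ∀ {X Y} h → X ≤ Y → rangeSum X h ≤ rangeSum Y h
  rangeSum-monoˡ {X} {Y} h X≤Y = begin
    rangeSum X h                                   ≤⟨ m≤m+n _ _ ⟩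
    rangeSum X h + rangeSum (Y ∸ X) (λ y → h (X + y)) ≡⟨ rangeSum-+ X (Y ∸ X) h ⟨
    rangeSum (X + (Y ∸ X)) h                       ≡⟨ cong (λ z → rangeSum z h) (m+[n∸m]≡n X≤Y) ⟩
    rangeSum Y h                                   ∎
    where open ≤-Reasoning

  rangeSum-shift : ∀ a X h → rangeSum X (λ x → h (x + a)) ≤ rangeSum (a + X) h
  rangeSum-shift a X h = begin
    rangeSum X (λ x → h (x + a))                   ≡⟨ rangeSum-cong X (λ x → cong h (+-comm x a)) ⟩
    rangeSum X (λ x → h (a + x))                   ≤⟨ m≤n+m _ _ ⟩
    rangeSum a h + rangeSum X (λ x → h (a + x))    ≡⟨ rangeSum-+ a X h ⟨
    rangeSum (a + X) h                             ∎
    where open ≤-Reasoning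

  -- The terms from n on vanish, so a longer range adds nothing and a shorter one only omits terms.
  -- This lets shifted sums run past the end of the sequence.
  rangeSum-support : ∀ n X h → (∀ x → h (n + x) ≡ 0) → rangeSum X h ≤ rangeSum n h
  rangeSum-support n X h h≡0 = begin
    rangeSum X h                                   ≤⟨ rangeSum-monoˡ h (m≤n+m X n) ⟩
    rangeSum (n + X) h                             ≡⟨ rangeSum-+ n X h ⟩
    rangeSum n h + rangeSum X (λ x → h (n + x))    ≡⟨ cong (rangeSum n h +_) (rangeSum-cong X h≡0) ⟩
    rangeSum n h + rangeSum X (λ _ → 0)            ≡⟨ cong (rangeSum n h +_) (trans (sum-const X 0) (*-zeroʳ X)) ⟩
    rangeSum n h + 0                               ≡⟨ +-identityʳ _ ⟩
    rangeSum n h                                   ∎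
    where open ≤-Reasoning

  term≤rangeSum : ∀ {X x} h → x < X → h x ≤ rangeSum X h
  term≤rangeSum {X} {x} h x<X = begin
    h x                     ≤⟨ m≤n+m _ _ ⟩
    rangeSum x h + h x      ≡⟨ rangeSum-suc x h ⟨
    rangeSum (suc x) h      ≤⟨ rangeSum-monoˡ h x<X ⟩
    rangeSum X h            ∎
    where open ≤-Reasoning

  rangeSum-≤ : ∀ X h → (∀ x → h x ≤ 1) → rangeSum X h ≤ X
  rangeSum-≤ X h h≤1 = begin
    rangeSum X h            ≤⟨ rangeSum-mono X (λ x _ → h≤1 x) ⟩
    rangeSum X (λ _ → 1)    ≡⟨ sum-const X 1 ⟩
    X * 1                   ≡⟨ *-identityʳ X ⟩
    X                       ∎
    where open ≤-Reasoning

  -- Division with remainder: the shifts of a grid of mesh M partition the positions. This turns an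
  -- average over random shifts into a single sum.
  rangeSum-grid : ∀ M r h →
    sum {M} (λ s → rangeSum r (λ j → h (toℕ s + j * M))) ≡ rangeSum (r * M) h
  rangeSum-grid M r h = trans (∑-comm {M} {r} _) (go r h)
    where
    go : ∀ r h → rangeSum r (λ j → rangeSum M (λ s → h (s + j * M))) ≡ rangeSum (r * M) h
    go zero    h = refl
    go (suc r) h = begin
      rangeSum M (λ s → h (s + 0)) + rangeSum r (λ j → rangeSum M (λ s → h (s + (M + j * M))))
        ≡⟨ cong₂ _+_ (rangeSum-cong M (λ s → cong h (+-identityʳ s)))
                     (rangeSum-cong r (λ j → rangeSum-cong M (λ s → cong h (swap s (j * M))))) ⟩
      rangeSum M h + rangeSum r (λ j → rangeSum M (λ s → h (M + (s + j * M))))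
        ≡⟨ cong (rangeSum M h +_) (go r (λ x → h (M + x))) ⟩
      rangeSum M h + rangeSum (r * M) (λ x → h (M + x))
        ≡⟨ rangeSum-+ M (r * M) h ⟨
      rangeSum (M + r * M) h ∎
      where
      open ≡-Reasoning
      swap : ∀ s b → s + (M + b) ≡ M + (s + b)
      swap s b = trans (sym (+-assoc s M b)) (trans (cong (_+ b) (+-comm s M)) (+-assoc M s b))

  -- Hamming distance as a sum over natural positions

  module Difference (em : ExcludedMiddle 0ℓ) {A : Set} {n : ℕ} (f g : Fin n → A) where

    -- Positions are natural numbers rather than elements of `Fin n`, so that x + 2 ^ k can be
    -- written without a bound; beyond the end nothing counts as a difference.
    Differs : ℕ → Set
    Differs x = ∃ λ i → toℕ i ≡ x × f i ≢ g i

    diff : ℕ → ℕ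
    diff x = ind (em {Differs x})

    distance : ℕ
    distance = sum (λ i → ind (em {f i ≢ g i}))

    distance≤rangeSum : distance ≤ rangeSum n diff
    distance≤rangeSum = sum-mono-≤ λ i →
      ind-mono (em {f i ≢ g i}) (em {Differs (toℕ i)}) λ fi≢gi → i , refl , fi≢gi

    rangeSum≤distance : ∀ X → rangeSum X diff ≤ distance
    rangeSum≤distance X = begin
      rangeSum X diff   ≤⟨ rangeSum-support n X diff (λ x → ind-false (em {Differs (n + x)})
                             λ (i , i≡n+x , _) → m+n≮m n x (subst (_< n) i≡n+x (Fin.toℕ<n i))) ⟩
      rangeSum n diff   ≤⟨ sum-mono-≤ (λ i → ind-mono (em {Differs (toℕ i)}) (em {f i ≢ g i})
                             λ (j , j≡i , fj≢gj) → subst (λ i → f i ≢ g i) (Fin.toℕ-injective j≡i) fj≢gj) ⟩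
      distance          ∎
      where open ≤-Reasoning

  -- The one consequence of locality on which the bisection rests. For y ≥ n the agreement is
  -- vacuous and the splice is `g` throughout.
  Spliceable : ∀ {A : Set} {n} → Pred (Fin n → A) 0ℓ → Set
  Spliceable P = ∀ g h y → g ∈ P → h ∈ P → (∀ i → toℕ i ≡ y → g i ≡ h i) →
    ∃ λ s → s ∈ P × (∀ i → toℕ i ≤ y → s i ≡ g i) × (∀ i → y ≤ toℕ i → s i ≡ h i)

  -- Repairing intervals by bisection

  module Interpolation (em : ExcludedMiddle 0ℓ) {A : Set} {n : ℕ} (P : Pred (Fin n → A) 0ℓ)
    (splice : Spliceable P)
    (f : Fin n → A) where

    Agree : (Fin n → A) → ℕ → Set
    Agree g x = ∀ i → toℕ i ≡ x → g i ≡ f i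

    -- Positions x ≥ n impose no condition.
    Joint : ℕ → ℕ → Set
    Joint x y = ∃ λ g → g ∈ P × Agree g x × Agree g y

    open Difference em f

    diffs : (Fin n → A) → ℕ → ℕ → ℕ
    diffs g x l = rangeSum l (λ i → diff g (x + i))

    -- The guard x < n keeps bad pairs countable inside the sequence even when `P` is empty. The
    -- second position may lie beyond the end; the pair is then bad if no member of `P` agrees with
    -- `f` at x.
    Bad : ℕ → ℕ → Set
    Bad k x = x < n × ¬ Joint x (x + 2 ^ k)

    bad : ℕ → ℕ → ℕ
    bad k x = ind (em {Bad k x})

    bads : ℕ → ℕ
    bads k = rangeSum n (bad k)

    -- An interval of level k + 1 with a bad half is rewritten entirely.
    repair : ℕ → ℕ → ℕ
    repair zero    x = 0
    repair (suc k) x =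
      2 ^ suc k * (bad k x + bad k (x + 2 ^ k)) + (repair k x + repair k (x + 2 ^ k))

    -- For x ≥ n both agreements are vacuous, so any member of `P` is a witness; this is why one
    -- must be supplied.
    joint-or-bad : ∃ P → ∀ k x → Joint x (x + 2 ^ k) ⊎ bad k x ≡ 1
    joint-or-bad (p , p∈P) k x with em {Joint x (x + 2 ^ k)} | x <? n
    ... | yes J | _       = inj₁ J
    ... | no ¬J | yes x<n = inj₂ (ind-true em (x<n , ¬J))
    ... | no ¬J | no  x≮n = inj₁ (p , p∈P , outside x≮n , outside (x≮n ∘ m+n≤o⇒m≤o (suc x)))
      where
      outside : ∀ {y} → ¬ y < n → Agree p y
      outside y≮n i refl = contradiction (Fin.toℕ<n i) y≮n

    diffs-≤ : ∀ g x l → diffs g x l ≤ l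
    diffs-≤ g x l = rangeSum-≤ l _ (λ i → ind-≤1 (em {Differs g (x + i)}))

    diffs-cong : ∀ {g h} x l → (∀ i → x ≤ toℕ i → toℕ i < x + l → g i ≡ h i) → diffs g x l ≤ diffs h x l
    diffs-cong {g} {h} x l g≈h = rangeSum-mono l λ j j<l →
      ind-mono (em {Differs g (x + j)}) (em {Differs h (x + j)}) λ where
      (i , i≡x+j , fi≢gi) → i , i≡x+j , λ fi≡hi → fi≢gi (trans fi≡hi (sym (g≈h i
        (subst (x ≤_) (sym i≡x+j) (m≤m+n x j)) (subst (_< x + l) (sym i≡x+j) (+-monoʳ-< x j<l)))))

    diffs-+ : ∀ g x a b → diffs g x (a + b) ≡ diffs g x a + diffs g (x + a) b
    diffs-+ g x a b = trans (rangeSum-+ a b (λ i → diff g (x + i)))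
      (cong (diffs g x a +_) (rangeSum-cong b (λ i → cong (diff g) (sym (+-assoc x a i)))))

    -- Both members agree with `f`, hence with each other, at x + a. Intervals are half-open, so
    -- this point is counted on the right only and the costs add.
    glue : ∀ {g h} x a b → g ∈ P → h ∈ P → Agree g (x + a) → Agree h (x + a) →
      ∃ λ s → s ∈ P × (∀ i → toℕ i ≤ x + a → s i ≡ g i) × (∀ i → x + a ≤ toℕ i → s i ≡ h i) ×
              diffs s x (a + b) ≤ diffs g x a + diffs h (x + a) b
    glue {g} {h} x a b g∈P h∈P gy hy
      with s , s∈P , s≈g , s≈h ← splice g h (x + a) g∈P h∈P (λ i e → trans (gy i e) (sym (hy i e)))
      = s , s∈P , s≈g , s≈h , (begin
        diffs s x (a + b)                    ≡⟨ diffs-+ s x a b ⟩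
        diffs s x a + diffs s (x + a) b      ≤⟨ +-mono-≤ (diffs-cong x a (λ i _ i<y → s≈g i (<⇒≤ i<y)))
                                                         (diffs-cong (x + a) b (λ i y≤i _ → s≈h i y≤i)) ⟩
        diffs g x a + diffs h (x + a) b      ∎)
      where open ≤-Reasoning

    Repairable : ℕ → ℕ → ℕ → Set
    Repairable x l c = ∃ λ g → g ∈ P × Agree g x × Agree g (x + l) × diffs g x l ≤ c

    -- Induction on the level. Agreement with `f` at both ends is carried along because it is what
    -- allows neighbouring intervals to be spliced.
    repairable : ∀ k x → Joint x (x + 2 ^ k) → Repairable x (2 ^ k) (repair k x)
    -- The half-open interval consists of x alone, where `g` already agrees with `f`.
    repairable zero x (g , g∈P , gx , gx+1) = g , g∈P , gx , gx+1 ,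
      ≤-reflexive (trans (+-identityʳ _) (ind-false em
        λ { (i , i≡x+0 , fi≢gi) → fi≢gi (sym (gx i (trans i≡x+0 (+-identityʳ x)))) }))
    repairable (suc k) x J@(g , g∈P , gx , gz)
      with joint-or-bad (g , g∈P) k x | joint-or-bad (g , g∈P) k (x + 2 ^ k)
    ... | inj₁ J₁ | inj₁ J₂
      with g₁ , g₁∈P , g₁x , g₁y , c₁ ← repairable k x J₁
         | g₂ , g₂∈P , g₂y , g₂z , c₂ ← repairable k (x + 2 ^ k) J₂
      with s , s∈P , s≈g₁ , s≈g₂ , c ← glue x (2 ^ k) (2 ^ k) g₁∈P g₂∈P g₁y g₂y
      = s , s∈P
      , (λ i i≡x → trans (s≈g₁ i (subst (_≤ x + 2 ^ k) (sym i≡x) (m≤m+n x _))) (g₁x i i≡x))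
      , (λ i i≡z → let i≡z′ = trans i≡z z≡z′ in
           trans (s≈g₂ i (subst (x + 2 ^ k ≤_) (sym i≡z′) (m≤m+n _ _))) (g₂z i i≡z′))
      , (begin
        diffs s x (2 ^ suc k)                        ≡⟨ cong (λ z → diffs s x (2 ^ k + z)) (+-identityʳ _) ⟩
        diffs s x (2 ^ k + 2 ^ k)                    ≤⟨ c ⟩
        diffs g₁ x (2 ^ k) + diffs g₂ (x + 2 ^ k) (2 ^ k) ≤⟨ +-mono-≤ c₁ c₂ ⟩
        repair k x + repair k (x + 2 ^ k)            ≤⟨ m≤n+m _ (2 ^ suc k * (bad k x + bad k (x + 2 ^ k))) ⟩
        repair (suc k) x                             ∎)
      where
      open ≤-Reasoning
      z≡z′ : x + 2 ^ suc k ≡ x + 2 ^ k + 2 ^ k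
      z≡z′ = trans (cong (λ z → x + (2 ^ k + z)) (+-identityʳ _)) (sym (+-assoc x _ _))
    -- The given witness differs from `f` on at most the 2 ^ suc k positions of the interval, and a
    -- bad half makes the first summand of `repair` at least that large.
    ... | inj₂ b | _      = g , g∈P , gx , gz , ≤-trans (diffs-≤ g x _) (≤-trans
      (m≤m*n (2 ^ suc k) (bad k x + bad k (x + 2 ^ k))
        {{>-nonZero (≤-trans (≤-reflexive (sym b)) (m≤m+n _ (bad k (x + 2 ^ k))))}})
      (m≤m+n _ _))
    ... | inj₁ _ | inj₂ b = g , g∈P , gx , gz , ≤-trans (diffs-≤ g x _) (≤-trans
      (m≤m*n (2 ^ suc k) (bad k x + bad k (x + 2 ^ k))
        {{>-nonZero (≤-trans (≤-reflexive (sym b)) (m≤n+m _ (bad k x)))}})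
      (m≤m+n _ _))

    -- Induction on the number r of blocks after the first, gluing one block on the left each time;
    -- so agreement is recorded at the left end.
    repairable-grid : ∀ K r x → (∀ j → j ≤ r → Joint (x + j * 2 ^ K) (x + j * 2 ^ K + 2 ^ K)) →
      ∃ λ g → g ∈ P × Agree g x ×
              diffs g x (suc r * 2 ^ K) ≤ rangeSum (suc r) (λ j → repair K (x + j * 2 ^ K))
    repairable-grid K zero x J
      with g , g∈P , gx , _ , c ← repairable K (x + 0) (J 0 z≤n)
      = g , g∈P , (λ i i≡x → gx i (trans i≡x (sym (+-identityʳ x)))) , (begin
        diffs g x (2 ^ K + 0)    ≡⟨ cong₂ (diffs g) (sym (+-identityʳ x)) (+-identityʳ (2 ^ K)) ⟩
        diffs g (x + 0) (2 ^ K)  ≤⟨ c ⟩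
        repair K (x + 0)         ≡⟨ +-identityʳ _ ⟨
        repair K (x + 0) + 0     ∎)
      where open ≤-Reasoning
    repairable-grid K (suc r) x J
      with g₁ , g₁∈P , g₁x , g₁y , c₁ ← repairable K x (subst (λ z → Joint z (z + 2 ^ K)) (+-identityʳ x) (J 0 z≤n))
         | g₂ , g₂∈P , g₂y , c₂ ← repairable-grid K r (x + 2 ^ K)
             (λ j j≤r → subst (λ z → Joint z (z + 2 ^ K)) (sym (+-assoc x (2 ^ K) (j * 2 ^ K))) (J (suc j) (s≤s j≤r)))
      with s , s∈P , s≈g₁ , s≈g₂ , c ← glue x (2 ^ K) (suc r * 2 ^ K) g₁∈P g₂∈P g₁y g₂y
      = s , s∈P
      , (λ i i≡x → trans (s≈g₁ i (subst (_≤ x + 2 ^ K) (sym i≡x) (m≤m+n x _))) (g₁x i i≡x))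
      , (begin
        diffs s x (2 ^ K + suc r * 2 ^ K)                          ≤⟨ c ⟩
        diffs g₁ x (2 ^ K) + diffs g₂ (x + 2 ^ K) (suc r * 2 ^ K)  ≤⟨ +-mono-≤ c₁ c₂ ⟩
        repair K x + rangeSum (suc r) (λ j → repair K (x + 2 ^ K + j * 2 ^ K))
          ≡⟨ cong₂ _+_ (cong (repair K) (sym (+-identityʳ x)))
                       (rangeSum-cong (suc r) (λ j → cong (repair K) (+-assoc x (2 ^ K) (j * 2 ^ K)))) ⟩
        rangeSum (suc (suc r)) (λ j → repair K (x + j * 2 ^ K))    ∎)
      where open ≤-Reasoning

    rangeSum-bad : ∀ k X → rangeSum X (bad k) ≤ bads k
    rangeSum-bad k X = rangeSum-support n X (bad k) λ x →
      ind-false (em {Bad k (n + x)}) λ (n+x<n , _) → m+n≮m n x n+x<n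

    -- Passing to the next level doubles the weight of every lower scale, since a position lies in
    -- both x and x + 2 ^ k roles, and charges each bad pair of scale k twice with weight 2 ^ suc k.
    -- All scales thus end with equal weight. The bound is uniform in X so that induction also
    -- covers the shifted sum.
    rangeSum-repair : ∀ k X → rangeSum X (repair k) ≤ 2 ^ suc k * rangeSum k bads
    rangeSum-repair zero    X = ≤-reflexive (trans (sum-const X 0) (*-zeroʳ X))
    rangeSum-repair (suc k) X = begin
      rangeSum X (repair (suc k))
        ≡⟨ ∑-distrib-+ {X} _ _ ⟩
      rangeSum X (λ x → 2 ^ suc k * (bad k x + bad k (x + 2 ^ k))) +
      rangeSum X (λ x → repair k x + repair k (x + 2 ^ k))
        ≡⟨ cong₂ _+_ (trans (sym (*-distribˡ-sum {X} (2 ^ suc k) _)) (cong (2 ^ suc k *_) (∑-distrib-+ {X} _ _)))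
                     (∑-distrib-+ {X} _ _) ⟩
      2 ^ suc k * (rangeSum X (bad k) + rangeSum X (λ x → bad k (x + 2 ^ k))) +
      (rangeSum X (repair k) + rangeSum X (λ x → repair k (x + 2 ^ k)))
        ≤⟨ +-mono-≤
             (*-monoʳ-≤ (2 ^ suc k) (+-mono-≤ (rangeSum-bad k X)
               (≤-trans (rangeSum-shift (2 ^ k) X (bad k)) (rangeSum-bad k (2 ^ k + X)))))
             (+-mono-≤ (rangeSum-repair k X)
               (≤-trans (rangeSum-shift (2 ^ k) X (repair k)) (rangeSum-repair k (2 ^ k + X)))) ⟩
      2 ^ suc k * (bads k + bads k) + (2 ^ suc k * S + 2 ^ suc k * S)
        ≡⟨ solve 3 (λ p b s → p :* (b :+ b) :+ (p :* s :+ p :* s) := (p :+ (p :+ con 0)) :* (s :+ b))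
             refl (2 ^ suc k) (bads k) S ⟩
      2 ^ suc (suc k) * (S + bads k)
        ≡⟨ cong (2 ^ suc (suc k) *_) (rangeSum-suc k bads) ⟨
      2 ^ suc (suc k) * rangeSum (suc k) bads ∎
      where
      open ≤-Reasoning
      open +-*-Solver
      S = rangeSum k bads

    -- Many bad pairs in a far sequence

    module _ (E K : ℕ) (far : ∀ g → g ∈ P → E ≤ distance g) (2^K≤n : 2 ^ K ≤ n) where

      -- The slack left once the positions before the grid, at most 2 ^ K - 1, are given up.
      slack : ℕ
      slack = suc E ∸ 2 ^ K

      -- If some grid interval is bad, the second term alone reaches `slack`. Otherwise repairing
      -- all intervals gives a member of `P`, and farness forces the repair costs to make up for
      -- everything but the positions before the grid.
      slack≤shift : ∀ s → s < 2 ^ K →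
        slack ≤ rangeSum n (λ j → repair K (s + j * 2 ^ K) + slack * bad K (s + j * 2 ^ K))
      slack≤shift s s<M = begin
        slack                     ≤⟨ main ⟩
        R + slack * B             ≡⟨ cong (R +_) (*-distribˡ-sum {n} slack _) ⟩
        R + rangeSum n (λ j → slack * bad K (s + j * 2 ^ K)) ≡⟨ ∑-distrib-+ {n} _ _ ⟨
        rangeSum n (λ j → repair K (s + j * 2 ^ K) + slack * bad K (s + j * 2 ^ K)) ∎
        where
        open ≤-Reasoning
        R = rangeSum n (λ j → repair K (s + j * 2 ^ K))
        B = rangeSum n (λ j → bad K (s + j * 2 ^ K))
        s<n = <-≤-trans s<M 2^K≤n

        main : slack ≤ R + slack * B
        main with B in B≡
        ... | suc b = ≤-trans (m≤m*n slack (suc b)) (m≤n+m _ R)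
        ... | zero  = ≤-trans (∸-monoˡ-≤ (2 ^ K) E<M+R) (≤-trans (≤-reflexive (m+n∸m≡n (2 ^ K) R)) (m≤m+n R _))
          where
          not-bad : ∀ j → j < n → bad K (s + j * 2 ^ K) ≡ 0
          not-bad j j<n = n≤0⇒n≡0 (subst (bad K (s + j * 2 ^ K) ≤_) B≡
            (term≤rangeSum (λ j → bad K (s + j * 2 ^ K)) j<n))
          -- `joint-or-bad` asks for a member of `P`, and none is known yet. Since s < n, the first
          -- interval can be decided directly and supplies one.
          first : Joint s (s + 2 ^ K)
          first with em {Joint s (s + 2 ^ K)}
          ... | yes J = J
          ... | no ¬J = contradiction
            (trans (sym (ind-true em (s<n , ¬J)))
              (trans (cong (bad K) (sym (+-identityʳ s))) (not-bad 0 (≤-<-trans z≤n s<n))))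
            λ ()
          joint : ∀ j → j ≤ pred n → Joint (s + j * 2 ^ K) (s + j * 2 ^ K + 2 ^ K)
          joint j j≤n-1 with joint-or-bad (proj₁ first , proj₁ (proj₂ first)) K (s + j * 2 ^ K)
          ... | inj₁ J = J
          ... | inj₂ b = contradiction (trans (sym b) (not-bad j
            (≤-<-trans j≤n-1 (pred-< {{>-nonZero (≤-<-trans z≤n s<n)}})))) λ ()
            where
            pred-< : ∀ {n} .{{_ : NonZero n}} → pred n < n
            pred-< {suc n} = ≤-refl
          suc-pred-n : suc (pred n) ≡ n
          suc-pred-n = suc-pred n {{>-nonZero (≤-<-trans z≤n s<n)}}
          -- The n blocks cover the whole sequence, as n ≤ s + n * 2 ^ K; the s positions before
          -- them are counted as lost.
          E<M+R : suc E ≤ 2 ^ K + R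
          E<M+R with g , g∈P , _ , c ← repairable-grid K (pred n) s joint = begin
            suc E                                            ≤⟨ s≤s (far g g∈P) ⟩
            suc (distance g)                                 ≤⟨ s≤s (distance≤rangeSum g) ⟩
            suc (rangeSum n (diff g))                        ≤⟨ s≤s (rangeSum-monoˡ (diff g) (≤-trans
                                                                  (m≤m*n n (2 ^ K) {{m^n≢0 2 K}}) (m≤n+m _ s))) ⟩
            suc (rangeSum (s + n * 2 ^ K) (diff g))          ≡⟨ cong suc (rangeSum-+ s _ (diff g)) ⟩
            suc (rangeSum s (diff g) + diffs g s (n * 2 ^ K)) ≤⟨ s≤s (+-mono-≤ (rangeSum-≤ s (diff g) (λ x → ind-≤1 em))
                   (subst (λ z → diffs g s (z * 2 ^ K) ≤ rangeSum z (λ j → repair K (s + j * 2 ^ K))) suc-pred-n c)) ⟩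
            suc s + R                                        ≤⟨ +-monoˡ-≤ R s<M ⟩
            2 ^ K + R                                        ∎

      -- Averaging slack≤shift over the 2 ^ K shifts.
      slack≤bads : suc E ≤ 4 * 2 ^ K → slack ≤ 4 * rangeSum (suc K) bads
      slack≤bads E<4M = *-cancelˡ-≤ (2 ^ K) {{m^n≢0 2 K}} (begin
        2 ^ K * slack
          ≡⟨ sum-const (2 ^ K) slack ⟨
        sum {2 ^ K} (λ _ → slack)
          ≤⟨ sum-mono-≤ {2 ^ K} (λ s → slack≤shift (toℕ s) (Fin.toℕ<n s)) ⟩
        sum {2 ^ K} (λ s → rangeSum n (λ j → repair K (toℕ s + j * 2 ^ K) + slack * bad K (toℕ s + j * 2 ^ K)))
          ≡⟨ rangeSum-grid (2 ^ K) n (λ x → repair K x + slack * bad K x) ⟩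
        rangeSum (n * 2 ^ K) (λ x → repair K x + slack * bad K x)
          ≡⟨ trans (∑-distrib-+ {n * 2 ^ K} _ _)
               (cong (rangeSum (n * 2 ^ K) (repair K) +_) (sym (*-distribˡ-sum {n * 2 ^ K} slack _))) ⟩
        rangeSum (n * 2 ^ K) (repair K) + slack * rangeSum (n * 2 ^ K) (bad K)
          ≤⟨ +-mono-≤ (rangeSum-repair K (n * 2 ^ K))
               (*-mono-≤ (≤-trans (m∸n≤m (suc E) (2 ^ K)) E<4M) (rangeSum-bad K (n * 2 ^ K))) ⟩
        2 ^ suc K * S + 4 * 2 ^ K * bads K
          -- The scales below K have weight 2 * 2 ^ K. Doubling it matches the weight 4 * 2 ^ K that
          -- bounds `slack` at scale K.
          ≤⟨ m≤m+n _ (2 ^ K * (2 * S)) ⟩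
        2 ^ suc K * S + 4 * 2 ^ K * bads K + 2 ^ K * (2 * S)
          ≡⟨ solve 3 (λ p s b → (p :+ (p :+ con 0)) :* s :+ con 4 :* p :* b :+ p :* (con 2 :* s) :=
                                p :* (con 4 :* (s :+ b)))
               refl (2 ^ K) S (bads K) ⟩
        2 ^ K * (4 * (S + bads K))
          ≡⟨ cong (λ z → 2 ^ K * (4 * z)) (rangeSum-suc K bads) ⟨
        2 ^ K * (4 * rangeSum (suc K) bads) ∎)
        where
        open ≤-Reasoning
        open +-*-Solver
        S = rangeSum K bads

      -- The mesh is at most half of E + 1, so `slack` is at least the other half, and E ≤ 2 *
      -- `slack`.
      far⇒bads : 2 * 2 ^ K ≤ suc E → suc E ≤ 4 * 2 ^ K → E ≤ 8 * rangeSum (suc K) bads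
      far⇒bads 2M≤E+1 E<4M = begin
        E                       ≤⟨ n≤1+n E ⟩
        suc E                   ≡⟨ m+[n∸m]≡n (≤-trans (m≤n*m (2 ^ K) 2) 2M≤E+1) ⟨
        2 ^ K + slack           ≤⟨ +-monoˡ-≤ slack M≤slack ⟩
        slack + slack           ≤⟨ +-mono-≤ (slack≤bads E<4M) (slack≤bads E<4M) ⟩
        4 * S + 4 * S           ≡⟨ solve 1 (λ s → con 4 :* s :+ con 4 :* s := con 8 :* s) refl S ⟩
        8 * S                   ∎
        where
        open ≤-Reasoning
        open +-*-Solver
        S = rangeSum (suc K) bads
        M≤slack : 2 ^ K ≤ slack
        M≤slack = begin
          2 ^ K                     ≡⟨ m+n∸n≡m (2 ^ K) (2 ^ K) ⟨
          2 ^ K + 2 ^ K ∸ 2 ^ K     ≡⟨ cong (λ z → 2 ^ K + z ∸ 2 ^ K) (sym (+-identityʳ _)) ⟩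
          2 * 2 ^ K ∸ 2 ^ K         ≤⟨ ∸-monoˡ-≤ (2 ^ K) 2M≤E+1 ⟩
          slack                     ∎

  -- Choice of the scale and decay of powers

  dyadic-scale : ∀ E → ∃ λ K → 2 * 2 ^ K ≤ suc (suc E) × suc (suc E) ≤ 4 * 2 ^ K
  dyadic-scale zero = 0 , ≤-refl , s≤s (s≤s z≤n)
  dyadic-scale (suc E) with K , lo , hi ← dyadic-scale E | suc (suc (suc E)) ≤? 4 * 2 ^ K
  ... | yes hi′ = K , ≤-trans lo (n≤1+n _) , hi′
  -- Failure of the upper bound for K is the lower bound for K + 1.
  ... | no ¬hi′ = suc K
    , ≤-trans (≤-reflexive (sym (*-assoc 2 2 (2 ^ K)))) (≤-trans (<⇒≤ (≰⇒> ¬hi′)) ≤-refl)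
    , (begin
      suc (suc (suc E))        ≤⟨ s≤s hi ⟩
      suc (4 * 2 ^ K)          ≤⟨ +-monoˡ-≤ (4 * 2 ^ K) (≤-trans (m^n>0 2 K) (m≤n*m (2 ^ K) 4)) ⟩
      4 * 2 ^ K + 4 * 2 ^ K    ≡⟨ solve 1 (λ p → con 4 :* p :+ con 4 :* p := con 4 :* (con 2 :* p)) refl (2 ^ K) ⟩
      4 * 2 ^ suc K            ∎)
    where
    open ≤-Reasoning
    open +-*-Solver

  -- Bernoulli's inequality (1 + d / q) ^ j ≥ 1 + j d / q, cleared of denominators.
  bernoulli : ∀ {q d N} → q + d ≤ N → ∀ j → q ^ j * (q + j * d) ≤ N ^ j * q
  bernoulli {q} q+d≤N zero = ≤-reflexive (cong (_+ 0) (+-identityʳ q))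
  bernoulli {q} {d} {N} q+d≤N (suc j) = begin
    q * q ^ j * (q + (d + j * d))
      ≤⟨ m≤m+n _ (q ^ j * (j * d * d)) ⟩
    q * q ^ j * (q + (d + j * d)) + q ^ j * (j * d * d)
      ≡⟨ solve 4 (λ q p j d → q :* p :* (q :+ (d :+ j :* d)) :+ p :* (j :* d :* d) :=
                              p :* (q :+ j :* d) :* (q :+ d)) refl q (q ^ j) j d ⟩
    q ^ j * (q + j * d) * (q + d)
      ≤⟨ *-mono-≤ (bernoulli q+d≤N j) q+d≤N ⟩
    N ^ j * q * N
      ≡⟨ solve 3 (λ p q N → p :* q :* N := N :* p :* q) refl (N ^ j) q N ⟩
    N * N ^ j * q ∎
    where
    open ≤-Reasoning
    open +-*-Solver

  -- Bernoulli gives (N / q) ^ m ≥ 1 + m d / q ≥ 1 + 5 N / q ≥ 6. The case q = 0 is split off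
  -- because the proof cancels q.
  power-decay : ∀ {q d N} m .{{_ : NonZero m}} → q + d ≤ N → 5 * N ≤ m * d → 6 * q ^ m ≤ N ^ m
  power-decay {zero}  {d} {N} (suc m) _ _ = z≤n
  power-decay {q@(suc _)} {d} {N} m q+d≤N 5N≤md = *-cancelʳ-≤ _ _ q (begin
    6 * q ^ m * q             ≡⟨ solve 2 (λ p q → con 6 :* p :* q := p :* (q :+ con 5 :* q)) refl (q ^ m) q ⟩
    q ^ m * (q + 5 * q)       ≤⟨ *-monoʳ-≤ (q ^ m) (+-monoʳ-≤ q (*-monoʳ-≤ 5 (m+n≤o⇒m≤o q q+d≤N))) ⟩
    q ^ m * (q + 5 * N)       ≤⟨ *-monoʳ-≤ (q ^ m) (+-monoʳ-≤ q 5N≤md) ⟩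
    q ^ m * (q + m * d)       ≤⟨ bernoulli q+d≤N m ⟩
    N ^ m * q                 ∎)
    where
    open ≤-Reasoning
    open +-*-Solver

  -- Repeated random batches and the union bound

  module BatchTester (em : ExcludedMiddle 0ℓ) (R : CompleteOrderedField) {n b N : ℕ}
    (P : Pred (Fin n → CompleteOrderedField.ℝ R) 0ℓ) (batch : Fin N → Vec (Fin n) b) where
    open Online em R

    -- An erased answer imposes no condition on `g`; this is the source of the one-sided error.
    Consistent : Batch n b → Vec Answer b → Set
    Consistent xs as = ∃ λ g → g ∈ P × (∀ i v → lookup as i ≡ just v → g (lookup xs i) ≡ v)

    round : Fin N → Strategy n b → Strategy n b
    round a rest = ask (batch a) λ as →
      if does (em {Consistent (batch a) as}) then rest else output false

    -- The seed is a number with j digits in base N whose leading digit chooses the current batch. A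
    -- uniform seed therefore gives independent uniform batches.
    run : ∀ j → Fin (N ^ j) → Strategy n b
    run zero    _ = output true
    run (suc j) s = round (quotient (N ^ j) s) (run j (remainder {N} (N ^ j) s))

    run-combine : ∀ j a r → run (suc j) (combine a r) ≡ round a (run j r)
    run-combine j a r = cong (λ (a , r) → round a (run j r)) (Fin.remQuot-combine a r)

    round-makesAtMost : ∀ {q rest} a → rest MakesAtMost q → round a rest MakesAtMost (b + q)
    round-makesAtMost {q} {rest} a rest≤q = ask λ as → branch (does (em {Consistent (batch a) as}))
      where
      branch : ∀ c → (if c then rest else output false) MakesAtMost q
      branch true  = rest≤q
      branch false = output

    run-makesAtMost : ∀ j s → run j s MakesAtMost (j * b)
    run-makesAtMost zero    s = output
    run-makesAtMost (suc j) s = round-makesAtMost (quotient (N ^ j) s) (run-makesAtMost j (remainder {N} (N ^ j) s))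

    module Analysis (f : Seq n) (𝒪 : Adversary n b) where

      Clean : List (Batch n b) → Fin N → Set
      Clean h a = ∀ i → 𝒪 h (lookup (batch a) i) ≡ just (f (lookup (batch a) i))

      -- Stated for the true values of `f`, without oracle or history, so that the same count
      -- applies in every round.
      Undetected : Fin N → Set
      Undetected a = ∃ λ g → g ∈ P × (∀ i → g (lookup (batch a) i) ≡ f (lookup (batch a) i))

      undetected : ℕ
      undetected = sum (λ a → ind (em {Undetected a}))

      dirty : List (Batch n b) → ℕ
      dirty h = sum (λ a → ind (em {¬ Clean h a}))

      outcomes : Bool → ∀ j → List (Batch n b) → ℕ
      outcomes v j h = sum (λ s → ind (execute (run j s) 𝒪 h Bool.≟ v))

      -- When every answer is a true value of `f`, the conditions `Consistent` and `Undetected`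
      -- coincide.
      execute-clean : ∀ h a rest → Clean h a →
        execute (round a rest) 𝒪 h ≡
        (if does (em {Undetected a}) then execute rest 𝒪 (batch a ∷ h) else false)
      execute-clean h a rest clean
        with em {Consistent (batch a) (Vec.map (𝒪 h) (batch a))} | em {Undetected a}
      ... | yes _ | yes _ = refl
      ... | no  _ | no  _ = refl
      ... | yes (g , g∈P , agree) | no ¬u = contradiction
        (g , g∈P , λ i → agree i _ (trans (lookup-map i (𝒪 h) (batch a)) (clean i))) ¬u
      ... | no ¬c | yes (g , g∈P , agree) = contradiction
        (g , g∈P , λ i v as≡v → trans (agree i)
          (just-injective (trans (sym (clean i)) (trans (sym (lookup-map i (𝒪 h) (batch a))) as≡v)))) ¬c

      -- By the hypothesis on `v`, a clean detected batch contributes nothing: it leads to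
      -- rejection, and it occurs only when acceptances are being counted. For an unclean batch all
      -- N ^ j continuations are counted.
      outcomes-step : ∀ v → (∀ a → ¬ Undetected a → v ≡ true) → ∀ j h a →
        sum (λ r → ind (execute (run (suc j) (combine a r)) 𝒪 h Bool.≟ v)) ≤
        ind (em {Undetected a}) * outcomes v j (batch a ∷ h) + ind (em {¬ Clean h a}) * N ^ j
      -- Deciding both propositions turns a doubly negated `Clean` into `Clean`.
      outcomes-step v detect j h a with em {¬ Clean h a} | em {Clean h a}
      ... | yes _ | _ = begin
        sum (λ r → ind (execute (run (suc j) (combine a r)) 𝒪 h Bool.≟ v))
                                    ≤⟨ sum-mono-≤ {N ^ j} (λ r → ind-≤1 (execute (run (suc j) (combine a r)) 𝒪 h Bool.≟ v)) ⟩
        sum {N ^ j} (λ _ → 1)       ≡⟨ sum-const (N ^ j) 1 ⟩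
        N ^ j * 1                   ≡⟨ *-comm (N ^ j) 1 ⟩
        1 * N ^ j                   ≤⟨ m≤n+m (1 * N ^ j) (ind (em {Undetected a}) * outcomes v j (batch a ∷ h)) ⟩
        ind (em {Undetected a}) * outcomes v j (batch a ∷ h) + 1 * N ^ j ∎
        where open ≤-Reasoning
      ... | no ¬dirty | no ¬clean = contradiction ¬clean ¬dirty
      ... | no _ | yes clean = begin
        sum (λ r → ind (execute (run (suc j) (combine a r)) 𝒪 h Bool.≟ v))
          ≡⟨ sum-cong-≗ (λ r → cong (λ w → ind (w Bool.≟ v))
               (trans (cong (λ S → execute S 𝒪 h) (run-combine j a r)) (execute-clean h a (run j r) clean))) ⟩
        sum (λ r → ind ((if does (em {Undetected a}) then execute (run j r) 𝒪 (batch a ∷ h) else false) Bool.≟ v))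
          ≤⟨ continue ⟩
        ind (em {Undetected a}) * outcomes v j (batch a ∷ h)
          ≡⟨ +-identityʳ _ ⟨
        ind (em {Undetected a}) * outcomes v j (batch a ∷ h) + 0 ∎
        where
        open ≤-Reasoning
        continue :
          sum (λ r → ind ((if does (em {Undetected a}) then execute (run j r) 𝒪 (batch a ∷ h) else false) Bool.≟ v)) ≤
          ind (em {Undetected a}) * outcomes v j (batch a ∷ h)
        continue with em {Undetected a}
        ... | yes _ = ≤-reflexive (sym (+-identityʳ _))
        ... | no ¬u with refl ← detect a ¬u = ≤-reflexive (trans (sum-const (N ^ j) 0) (*-zeroʳ (N ^ j)))

      -- A union bound: an unclean batch counts as a failure whatever follows, so the
      -- term j * N ^ j gathers j failures of probability at most 1 / μ each.
      outcomes-bound : ∀ {m} μ → (∀ h → length h < m → μ * dirty h ≤ N) → undetected ≤ N →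
        ∀ v → (∀ a → ¬ Undetected a → v ≡ true) →
        ∀ j h → length h + j ≤ m →
        μ * outcomes v j h ≤ μ * ind (true Bool.≟ v) * undetected ^ j + j * N ^ j
      outcomes-bound μ few q≤N v detect zero h _ =
        ≤-reflexive (trans (cong (μ *_) (+-identityʳ _)) (sym (trans (+-identityʳ _) (*-identityʳ _))))
      outcomes-bound {m} μ few q≤N v detect (suc j) h len = begin
        μ * outcomes v (suc j) h
          ≡⟨ cong (μ *_) (sum-combine N {N ^ j} (λ s → ind (execute (run (suc j) s) 𝒪 h Bool.≟ v))) ⟩
        μ * sum {N} (λ a → sum {N ^ j} (λ r → ind (execute (run (suc j) (combine a r)) 𝒪 h Bool.≟ v)))
          ≤⟨ *-monoʳ-≤ μ (sum-mono-≤ {N} (outcomes-step v detect j h)) ⟩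
        μ * sum {N} (λ a → u a * outcomes v j (batch a ∷ h) + dirt a * N ^ j)
          ≡⟨ *-distribˡ-sum {N} μ _ ⟩
        sum (λ a → μ * (u a * outcomes v j (batch a ∷ h) + dirt a * N ^ j))
          ≤⟨ sum-mono-≤ {N} step ⟩
        sum (λ a → u a * X + dirt a * (μ * N ^ j))
          ≡⟨ trans (∑-distrib-+ {N} _ _)
               (sym (cong₂ _+_ (*-distribʳ-sum {N} X u) (*-distribʳ-sum {N} (μ * N ^ j) dirt))) ⟩
        q * X + dirty h * (μ * N ^ j)
          ≡⟨ solve 6 (λ q e p j M d → q :* (e :* p :+ j :* M) :+ d := e :* (q :* p) :+ q :* (j :* M) :+ d) refl
               q (μ * e) (q ^ j) j (N ^ j) (dirty h * (μ * N ^ j)) ⟩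
        μ * e * (q * q ^ j) + q * (j * N ^ j) + dirty h * (μ * N ^ j)
          ≤⟨ +-mono-≤ (+-monoʳ-≤ (μ * e * (q * q ^ j)) (*-monoˡ-≤ (j * N ^ j) q≤N)) dirt-bound ⟩
        μ * e * (q * q ^ j) + N * (j * N ^ j) + N * N ^ j
          ≡⟨ solve 4 (λ a N j M → a :+ N :* (j :* M) :+ N :* M := a :+ (N :* M :+ j :* (N :* M))) refl
               (μ * e * (q * q ^ j)) N j (N ^ j) ⟩
        μ * e * (q * q ^ j) + (N * N ^ j + j * (N * N ^ j)) ∎
        where
        open ≤-Reasoning
        open +-*-Solver
        e = ind (true Bool.≟ v)
        q = undetected
        u = λ a → ind (em {Undetected a})
        dirt = λ a → ind (em {¬ Clean h a})
        X = μ * e * q ^ j + j * N ^ j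
        step : ∀ a → μ * (u a * outcomes v j (batch a ∷ h) + dirt a * N ^ j) ≤ u a * X + dirt a * (μ * N ^ j)
        step a = begin
          μ * (u a * outcomes v j (batch a ∷ h) + dirt a * N ^ j)
            ≡⟨ solve 5 (λ μ u o d M → μ :* (u :* o :+ d :* M) := u :* (μ :* o) :+ d :* (μ :* M)) refl
                 μ (u a) (outcomes v j (batch a ∷ h)) (dirt a) (N ^ j) ⟩
          u a * (μ * outcomes v j (batch a ∷ h)) + dirt a * (μ * N ^ j)
            ≤⟨ +-monoˡ-≤ _ (*-monoʳ-≤ (u a) (outcomes-bound μ few q≤N v detect j (batch a ∷ h)
                 (≤-trans (≤-reflexive (sym (+-suc (length h) j))) len))) ⟩
          u a * X + dirt a * (μ * N ^ j) ∎
        dirt-bound : dirty h * (μ * N ^ j) ≤ N * N ^ j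
        dirt-bound = begin
          dirty h * (μ * N ^ j)   ≡⟨ solve 3 (λ d μ M → d :* (μ :* M) := μ :* d :* M) refl (dirty h) μ (N ^ j) ⟩
          μ * dirty h * N ^ j     ≤⟨ *-monoˡ-≤ (N ^ j) (few h (≤-trans (s≤s (m≤m+n (length h) j))
                                       (≤-trans (≤-reflexive (sym (+-suc (length h) j))) len))) ⟩
          N * N ^ j               ∎

      undetected≤N : undetected ≤ N
      undetected≤N = begin
        undetected        ≤⟨ sum-mono-≤ (λ a → ind-≤1 (em {Undetected a})) ⟩
        sum {N} (λ _ → 1) ≡⟨ trans (sum-const N 1) (*-identityʳ N) ⟩
        N                 ∎
        where open ≤-Reasoning

      module _ {m} .{{_ : NonZero m}} (few : ∀ h → length h < m → 6 * m * dirty h ≤ N) where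

        -- Every batch is undetected, witnessed by `f` itself, and a run without rejection accepts,
        -- so the main term vanishes. The m unclean batches leave a failure probability of m / (6 m)
        -- = 1/6.
        few-rejections : f ∈ P → 3 * outcomes false m [] ≤ N ^ m
        few-rejections f∈P = *-cancelˡ-≤ m (begin
          m * (3 * o)          ≤⟨ m≤m+n _ (m * (3 * o)) ⟩
          m * (3 * o) + m * (3 * o)
                               ≡⟨ solve 2 (λ m o → m :* (con 3 :* o) :+ m :* (con 3 :* o) := con 6 :* m :* o) refl m o ⟩
          6 * m * o            ≤⟨ outcomes-bound (6 * m) few undetected≤N false
                                    (λ a ¬u → contradiction (f , f∈P , λ i → refl) ¬u) m [] ≤-refl ⟩
          6 * m * 0 * undetected ^ m + m * N ^ m ≡⟨ cong (λ z → z * undetected ^ m + m * N ^ m) (*-zeroʳ (6 * m)) ⟩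
          m * N ^ m            ∎)
          where
          open ≤-Reasoning
          open +-*-Solver
          o = outcomes false m []

        -- Two failures of probability at most 1/6 each: meeting an unclean batch, and drawing m
        -- undetected batches in a row.
        few-acceptances : ∀ {d} → undetected + d ≤ N → 5 * N ≤ m * d → 3 * outcomes true m [] ≤ N ^ m
        few-acceptances {d} q+d≤N 5N≤md = *-cancelˡ-≤ (m + m) {{>-nonZero (≤-trans (>-nonZero⁻¹ m) (m≤m+n m m))}} (begin
          (m + m) * (3 * o)    ≡⟨ solve 2 (λ m o → (m :+ m) :* (con 3 :* o) := con 6 :* m :* o) refl m o ⟩
          6 * m * o            ≤⟨ outcomes-bound (6 * m) few undetected≤N true (λ _ _ → refl) m [] ≤-refl ⟩
          6 * m * 1 * q ^ m + m * N ^ m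
                               ≡⟨ solve 3 (λ m p M → con 6 :* m :* con 1 :* p :+ M := m :* (con 6 :* p) :+ M)
                                    refl m (q ^ m) (m * N ^ m) ⟩
          m * (6 * q ^ m) + m * N ^ m ≤⟨ +-monoˡ-≤ (m * N ^ m) (*-monoʳ-≤ m (power-decay m q+d≤N 5N≤md)) ⟩
          m * N ^ m + m * N ^ m ≡⟨ *-distribʳ-+ (N ^ m) m m ⟨
          (m + m) * N ^ m      ∎)
          where
          open ≤-Reasoning
          open +-*-Solver
          o = outcomes true m []
          q = undetected

      -- The surviving answers are true values, so `f` itself keeps every round consistent, however
      -- much has been erased.
      always-accepts : (∀ h x → 𝒪 h x ≡ just (f x) ⊎ 𝒪 h x ≡ nothing) → f ∈ P →
        ∀ j s h → execute (run j s) 𝒪 h ≡ true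
      always-accepts erased f∈P zero    s h = refl
      always-accepts erased f∈P (suc j) s h
        with em {Consistent (batch (quotient (N ^ j) s)) (Vec.map (𝒪 h) (batch (quotient (N ^ j) s)))}
      ... | yes _ = always-accepts erased f∈P j (remainder {N} (N ^ j) s) _
      ... | no ¬c = contradiction (f , f∈P , agree) ¬c
        where
        xs = batch (quotient (N ^ j) s)
        agree : ∀ i v → lookup (Vec.map (𝒪 h) xs) i ≡ just v → f (lookup xs i) ≡ v
        agree i v eq with erased h (lookup xs i) | trans (sym (lookup-map i (𝒪 h) xs)) eq
        ... | inj₁ e | e′ = just-injective (trans (sym e) e′)
        ... | inj₂ e | e′ = contradiction (trans (sym e) e′) λ ()

  -- From counts of seeds to probabilities

  module Probability (em : ExcludedMiddle 0ℓ) (R : CompleteOrderedField) where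
    open Online em R

    -- The union bound limits the seeds with the wrong verdict; these are complementary to the seeds
    -- counted by `Pr`.
    Pr≥2/3 : ∀ {n b} (T : Tester n b) 𝒪 v →
      3 * sum (λ s → ind (result T 𝒪 s Bool.≟ not v)) ≤ Tester.seeds T → 2/3 ℚᵘ.≤ Pr T 𝒪 v
    Pr≥2/3 T 𝒪 v few = go (Tester.seeds T) {{Tester.nonZero T}} _ bound
      where
      open ≤-Reasoning
      open +-*-Solver
      yeses = length (filter (λ s → result T 𝒪 s Bool.≟ v) (tabulate id))
      noes  = sum (λ s → ind (result T 𝒪 s Bool.≟ not v))

      complementary : ∀ w v → ind (w Bool.≟ v) + ind (w Bool.≟ not v) ≡ 1
      complementary false false = refl
      complementary false true  = refl
      complementary true  false = refl
      complementary true  true  = refl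

      total : yeses + noes ≡ Tester.seeds T
      total = begin-equality
        yeses + noes    ≡⟨ cong (_+ noes) (length-filter-tabulate (λ s → result T 𝒪 s Bool.≟ v) id) ⟩
        sum (λ s → ind (result T 𝒪 s Bool.≟ v)) + noes ≡⟨ ∑-distrib-+ {Tester.seeds T} _ _ ⟨
        sum (λ s → ind (result T 𝒪 s Bool.≟ v) + ind (result T 𝒪 s Bool.≟ not v))
                        ≡⟨ sum-cong-≗ (λ s → complementary (result T 𝒪 s) v) ⟩
        sum {Tester.seeds T} (λ _ → 1) ≡⟨ trans (sum-const (Tester.seeds T) 1) (*-identityʳ _) ⟩
        Tester.seeds T  ∎

      bound : 2 * Tester.seeds T ≤ yeses * 3
      bound = +-cancelʳ-≤ (3 * noes) _ _ (begin
        2 * Tester.seeds T + 3 * noes            ≤⟨ +-monoʳ-≤ (2 * Tester.seeds T) few ⟩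
        2 * Tester.seeds T + Tester.seeds T      ≡⟨ solve 1 (λ s → con 2 :* s :+ s := con 3 :* s) refl (Tester.seeds T) ⟩
        3 * Tester.seeds T                       ≡⟨ cong (3 *_) total ⟨
        3 * (yeses + noes)                       ≡⟨ solve 2 (λ a b → con 3 :* (a :+ b) := a :* con 3 :+ con 3 :* b)
                                                     refl yeses noes ⟩
        yeses * 3 + 3 * noes                     ∎)

      go : ∀ s {{_ : NonZero s}} c → 2 * s ≤ c * 3 → 2/3 ℚᵘ.≤ (ℤ.+ c ℚᵘ./ s)
      go (suc s) c p = ℚᵘ.*≤* (subst₂ ℤ._≤_ (ℤ.pos-* 2 (suc s)) (ℤ.pos-* c 3) (ℤ.+≤+ p))

  -- Batches of pairs at dyadic distances

  module PairTester (em : ExcludedMiddle 0ℓ) (R : CompleteOrderedField) {n : ℕ} (K : ℕ)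
    (P : Pred (Fin n → CompleteOrderedField.ℝ R) 0ℓ) where
    open Online em R

    -- If x + l leaves the sequence, x is queried twice. This matches `Joint`, whose second
    -- condition is then vacuous.
    partner : ℕ → Fin n → Fin n
    partner l x with toℕ x + l <? n
    ... | yes x+l<n = fromℕ< x+l<n
    ... | no  _     = x

    partner-cases : ∀ l x → toℕ (partner l x) ≡ toℕ x + l ⊎ partner l x ≡ x × ¬ toℕ x + l < n
    partner-cases l x with toℕ x + l <? n
    ... | yes x+l<n = inj₁ (Fin.toℕ-fromℕ< x+l<n)
    ... | no  x+l≮n = inj₂ (refl , x+l≮n)

    pair : Fin (suc K) → Fin n → Batch n 2
    pair k x = x ∷ partner (2 ^ toℕ k) x ∷ []

    batch : Fin (suc K * n) → Batch n 2
    batch a = uncurry pair (remQuot n a)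

    batch-combine : ∀ k x → batch (combine k x) ≡ pair k x
    batch-combine k x = cong (uncurry pair) (Fin.remQuot-combine k x)

    open BatchTester em R P batch public

    tester : .{{_ : NonZero n}} → ℕ → Tester n 2
    tester m = record
      { seeds    = (suc K * n) ^ m
      ; nonZero  = m^n≢0 (suc K * n) m {{m*n≢0 (suc K) n}}
      ; strategy = run m
      }

    module _ (f : Seq n) (𝒪 : Adversary n 2) (initial : ∀ x → 𝒪 [] x ≡ just (f x)) where
      open Analysis f 𝒪

      -- At a fixed scale, a changed position spoils at most two pairs: the one that starts there
      -- and the one whose second point lies there. A repeated query is covered by the first case.
      dirty≤ : ∀ h → dirty h ≤ suc K * (2 * Difference.distance em (𝒪 []) (𝒪 h))
      dirty≤ h = begin
        dirty h
          ≡⟨ sum-combine (suc K) {n} (λ a → ind (em {¬ Clean h a})) ⟩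
        sum {suc K} (λ k → sum {n} (λ x → ind (em {¬ Clean h (combine k x)})))
          ≤⟨ sum-mono-≤ {suc K} (λ k → sum-mono-≤ {n} (λ x →
               ind-⊎ (em {¬ Clean h (combine k x)}) (em {Differs (toℕ x)})
                 (em {Differs (toℕ x + 2 ^ toℕ k)}) (moved k x))) ⟩
        sum {suc K} (λ k → sum {n} (λ x → diff (toℕ x) + diff (toℕ x + 2 ^ toℕ k)))
          ≤⟨ sum-mono-≤ {suc K} (λ k → begin
               sum {n} (λ x → diff (toℕ x) + diff (toℕ x + 2 ^ toℕ k))
                 ≡⟨ ∑-distrib-+ {n} _ _ ⟩
               rangeSum n diff + rangeSum n (λ x → diff (x + 2 ^ toℕ k))
                 ≤⟨ +-mono-≤ (rangeSum≤distance n)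
                             (≤-trans (rangeSum-shift (2 ^ toℕ k) n diff) (rangeSum≤distance (2 ^ toℕ k + n))) ⟩
               distance + distance
                 ≡⟨ cong (distance +_) (+-identityʳ distance) ⟨
               2 * distance ∎) ⟩
        sum {suc K} (λ _ → 2 * distance)
          ≡⟨ sum-const (suc K) (2 * distance) ⟩
        suc K * (2 * distance) ∎
        where
        open ≤-Reasoning
        open Difference em (𝒪 []) (𝒪 h)

        unmoved : ∀ {y} x → toℕ x ≡ y → ¬ Differs y → 𝒪 h x ≡ just (f x)
        unmoved x x≡y ¬d with em {𝒪 [] x ≡ 𝒪 h x}
        ... | yes e = trans (sym e) (initial x)
        ... | no ¬e = contradiction (x , x≡y , ¬e) ¬d

        moved : ∀ k x → ¬ Clean h (combine k x) → Differs (toℕ x) ⊎ Differs (toℕ x + 2 ^ toℕ k)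
        moved k x ¬clean with em {Differs (toℕ x)} | em {Differs (toℕ x + 2 ^ toℕ k)}
        ... | yes d | _     = inj₁ d
        ... | no _  | yes d = inj₂ d
        ... | no ¬d | no ¬d′ = contradiction
          (subst (λ xs → ∀ i → 𝒪 h (lookup xs i) ≡ just (f (lookup xs i))) (sym (batch-combine k x)) clean) ¬clean
          where
          clean : ∀ i → 𝒪 h (lookup (pair k x) i) ≡ just (f (lookup (pair k x) i))
          clean Fin.zero = unmoved x refl ¬d
          clean (Fin.suc Fin.zero) with partner-cases (2 ^ toℕ k) x
          ... | inj₁ e       = unmoved _ e ¬d′
          ... | inj₂ (e , _) = unmoved _ (cong toℕ e) ¬d

      module _ (splice : Spliceable P) where
        open Interpolation em P splice f

        -- A member of `P` that leaves a batch undetected makes its pair joint, so undetected and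
        -- bad exclude each other.
        undetected+bads≤ : undetected + rangeSum (suc K) bads ≤ suc K * n
        undetected+bads≤ = begin
          undetected + rangeSum (suc K) bads
            ≡⟨ cong (_+ rangeSum (suc K) bads) (sum-combine (suc K) {n} (λ a → ind (em {Undetected a}))) ⟩
          sum {suc K} (λ k → sum (u k)) + rangeSum (suc K) bads
            ≡⟨ ∑-distrib-+ {suc K} (λ k → sum (u k)) (bads ∘ toℕ) ⟨
          sum {suc K} (λ k → sum (u k) + bads (toℕ k))
            ≡⟨ sum-cong-≗ {suc K} (λ k → sym (∑-distrib-+ {n} (u k) (bad (toℕ k) ∘ toℕ))) ⟩
          sum {suc K} (λ k → sum {n} (λ x → u k x + bad (toℕ k) (toℕ x)))
            ≤⟨ sum-mono-≤ {suc K} (λ k → sum-mono-≤ {n} (λ x →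
                 ind-disjoint (em {Undetected (combine k x)}) (em {Bad (toℕ k) (toℕ x)}) (exclusive k x))) ⟩
          sum {suc K} (λ k → sum {n} (λ x → 1))
            ≡⟨ sum-cong-≗ {suc K} (λ k → trans (sum-const n 1) (*-identityʳ n)) ⟩
          sum {suc K} (λ k → n)
            ≡⟨ sum-const (suc K) n ⟩
          suc K * n ∎
          where
          open ≤-Reasoning
          u : Fin (suc K) → Fin n → ℕ
          u k x = ind (em {Undetected (combine k x)})

          exclusive : ∀ k x → Undetected (combine k x) → ¬ Bad (toℕ k) (toℕ x)
          exclusive k x u (_ , ¬joint) with
            g , g∈P , agree ← subst (λ xs → ∃ λ g → g ∈ P × ∀ i → g (lookup xs i) ≡ f (lookup xs i))
                                      (batch-combine k x) u
            = ¬joint (g , g∈P , at Fin.zero refl , at-partner (partner-cases (2 ^ toℕ k) x))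
            where
            at : ∀ i {y} → toℕ (lookup (pair k x) i) ≡ y → Agree g y
            at i e j j≡y with refl ← Fin.toℕ-injective (trans j≡y (sym e)) = agree i
            at-partner : toℕ (partner (2 ^ toℕ k) x) ≡ toℕ x + 2 ^ toℕ k ⊎ _ × ¬ toℕ x + 2 ^ toℕ k < n →
                         Agree g (toℕ x + 2 ^ toℕ k)
            at-partner (inj₁ e)       = at (Fin.suc Fin.zero) e
            at-partner (inj₂ (_ , o)) j j≡ = contradiction (subst (_< n) j≡ (Fin.toℕ<n j)) o

      module _ .{{_ : NonZero n}} {m} .{{_ : NonZero m}}
        (budget : ∀ h → length h < m → 12 * m * Dist (𝒪 []) (𝒪 h) ≤ n) where

        -- The 12 of the budget is the 6 of the union bound times the two queries of a batch.
        few-dirty : ∀ h → length h < m → 6 * m * dirty h ≤ suc K * n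
        few-dirty h h<m = begin
          6 * m * dirty h
            ≤⟨ *-monoʳ-≤ (6 * m) (dirty≤ h) ⟩
          6 * m * (suc K * (2 * D))
            ≡⟨ solve 3 (λ m k d → con 6 :* m :* (k :* (con 2 :* d)) := k :* (con 12 :* m :* d)) refl m (suc K) D ⟩
          suc K * (12 * m * D)
            ≡⟨ cong (λ d → suc K * (12 * m * d)) (length-filter-tabulate (λ x → em {𝒪 [] x ≢ 𝒪 h x}) id) ⟨
          suc K * (12 * m * Dist (𝒪 []) (𝒪 h))
            ≤⟨ *-monoʳ-≤ (suc K) (budget h h<m) ⟩
          suc K * n ∎
          where
          open ≤-Reasoning
          open +-*-Solver
          D = Difference.distance em (𝒪 []) (𝒪 h)

        open Probability em R

        accepts : f ∈ P → 2/3 ℚᵘ.≤ Pr (tester m) 𝒪 true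
        accepts f∈P = Pr≥2/3 (tester m) 𝒪 true (few-rejections {m} few-dirty f∈P)

        -- There are at least E / 8 bad pairs. The constant 40 is this 8 times the 5 required by
        -- `power-decay`.
        rejects : Spliceable P → ∀ {E} → 2 * 2 ^ K ≤ suc E → suc E ≤ 4 * 2 ^ K → E ≤ n →
          40 * (suc K * n) ≤ m * E → (∀ g → g ∈ P → E ≤ Dist f g) → 2/3 ℚᵘ.≤ Pr (tester m) 𝒪 false
        rejects splice {E} lo hi E≤n enough far =
          Pr≥2/3 (tester m) 𝒪 false (few-acceptances {m} few-dirty {d} (undetected+bads≤ splice) (*-cancelˡ-≤ 8 (begin
            8 * (5 * (suc K * n))  ≡⟨ *-assoc 8 5 (suc K * n) ⟨
            40 * (suc K * n)       ≤⟨ enough ⟩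
            m * E                  ≤⟨ *-monoʳ-≤ m (far⇒bads E K far′ 2^K≤n lo hi) ⟩
            m * (8 * d)            ≡⟨ solve 2 (λ m d → m :* (con 8 :* d) := con 8 :* (m :* d)) refl m d ⟩
            8 * (m * d)            ∎)))
          where
          open ≤-Reasoning
          open +-*-Solver
          open Interpolation em P splice f
          d = rangeSum (suc K) bads
          far′ : ∀ g → g ∈ P → E ≤ Difference.distance em f g
          far′ g g∈P = subst (E ≤_) (length-filter-tabulate (λ x → em {f x ≢ g x}) id) (far g g∈P)
          2^K≤n : 2 ^ K ≤ n
          2^K≤n = s≤s⁻¹ (begin
            1 + 2 ^ K      ≤⟨ +-monoˡ-≤ (2 ^ K) (m^n>0 2 K) ⟩
            2 ^ K + 2 ^ K  ≡⟨ cong (2 ^ K +_) (+-identityʳ (2 ^ K)) ⟨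
            2 * 2 ^ K      ≤⟨ lo ⟩
            suc E          ≤⟨ s≤s E≤n ⟩
            suc n          ∎)

  -- Local properties admit splicing

  module Locality (em : ExcludedMiddle 0ℓ) (R : CompleteOrderedField) {n : ℕ}
    (P : Pred (Fin n → CompleteOrderedField.ℝ R) 0ℓ) where
    open Online em R

    -- As `g` and `h` agree at y, each consecutive pair of the splice comes wholly from `g` if it
    -- starts before y, and wholly from `h` otherwise. No new pair arises.
    local-splice : IsLocal P → Spliceable P
    local-splice (F , P⇔) g h y g∈P h∈P g≡h = s , Equivalence.from (P⇔ s) allowed , s≡g , s≡h
      where
      s : Seq n
      s i with toℕ i ≤? y
      ... | yes _ = g i
      ... | no  _ = h i

      s≡g : ∀ i → toℕ i ≤ y → s i ≡ g i
      s≡g i i≤y with toℕ i ≤? y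
      ... | yes _   = refl
      ... | no  i≰y = contradiction i≤y i≰y

      s≡h : ∀ i → y ≤ toℕ i → s i ≡ h i
      s≡h i y≤i with toℕ i ≤? y
      ... | yes i≤y = g≡h i (≤-antisym i≤y y≤i)
      ... | no  _   = refl

      allowed : ∀ i j → toℕ j ≡ suc (toℕ i) → ¬ F (s i , s j)
      allowed i j j≡i+1 with toℕ i <? y
      ... | yes i<y = subst (¬_ ∘ F) (sym (cong₂ _,_ (s≡g i (<⇒≤ i<y)) (s≡g j (subst (_≤ y) (sym j≡i+1) i<y))))
                        (Equivalence.to (P⇔ g) g∈P i j j≡i+1)
      ... | no  i≮y = subst (¬_ ∘ F) (sym (cong₂ _,_ (s≡h i y≤i)
                        (s≡h j (≤-trans y≤i (≤-trans (n≤1+n _) (≤-reflexive (sym j≡i+1)))))))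
                        (Equivalence.to (P⇔ h) h∈P i j j≡i+1)
        where y≤i = ≮⇒≥ i≮y

open Combinatorics

-- Ordered field arithmetic and the embedding of the naturals

module OrderedField (R : CompleteOrderedField) where
  open CompleteOrderedField R
  open CommutativeRing commutativeRing public using
    ( +-identityˡ; +-identityʳ; +-assoc; +-comm; -‿inverseʳ
    ; *-identityˡ; *-identityʳ; *-assoc; *-comm; zeroˡ; zeroʳ; distribʳ)
  open TotalOrder totalOrder public using (poset; total)
    renaming (refl to ≤-refl; trans to ≤-trans; antisym to ≤-antisym; reflexive to ≤-reflexive)
  open PartialOrderReasoning poset public
  open SemiringSolver (CommutativeRing.commutativeSemiring commutativeRing) public
    using (solve; _:=_; _:*_)
  private
    module Ring = RingProperties (CommutativeRing.ring commutativeRing)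
    module Mult = SemiringMult (CommutativeRing.semiring commutativeRing)
    module Exp  = SemiringExp (CommutativeRing.semiring commutativeRing)

  x+[y-x]≡y : ∀ x y → x + (y - x) ≡ y
  x+[y-x]≡y x y = trans (+-comm x (y - x)) (trans (+-assoc y (- x) x)
    (trans (cong (y +_) (trans (+-comm (- x) x) (-‿inverseʳ x))) (+-identityʳ y)))

  +-mono-≤ : ∀ {a b c d} → a ≤ b → c ≤ d → a + c ≤ b + d
  +-mono-≤ {a} {b} {c} {d} a≤b c≤d = begin
    a + c  ≤⟨ +-monoˡ-≤ c a≤b ⟩
    b + c  ≡⟨ +-comm b c ⟩
    c + b  ≤⟨ +-monoˡ-≤ b c≤d ⟩
    d + b  ≡⟨ +-comm d b ⟩
    b + d  ∎

  *-monoˡ-≤ : ∀ {x y z} → 0# ≤ z → x ≤ y → x * z ≤ y * z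
  *-monoˡ-≤ {x} {y} {z} 0≤z x≤y = begin
    x * z                  ≡⟨ +-identityʳ _ ⟨
    x * z + 0#             ≤⟨ +-mono-≤ ≤-refl (*-nonneg 0≤y-x 0≤z) ⟩
    x * z + (y - x) * z    ≡⟨ distribʳ z x (y - x) ⟨
    (x + (y - x)) * z      ≡⟨ cong (_* z) (x+[y-x]≡y x y) ⟩
    y * z                  ∎
    where
    0≤y-x : 0# ≤ y - x
    0≤y-x = subst (_≤ y - x) (-‿inverseʳ x) (+-monoˡ-≤ (- x) x≤y)

  *-monoʳ-≤ : ∀ {x y z} → 0# ≤ z → x ≤ y → z * x ≤ z * y
  *-monoʳ-≤ {x} {y} {z} 0≤z x≤y = subst₂ _≤_ (*-comm x z) (*-comm y z) (*-monoˡ-≤ 0≤z x≤y)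

  *-mono-≤ : ∀ {a b c d} → 0# ≤ b → 0# ≤ c → a ≤ b → c ≤ d → a * c ≤ b * d
  *-mono-≤ 0≤b 0≤c a≤b c≤d = ≤-trans (*-monoˡ-≤ 0≤c a≤b) (*-monoʳ-≤ 0≤b c≤d)

  0≤1 : 0# ≤ 1#
  0≤1 with total 0# 1#
  ... | inj₁ 0≤1 = 0≤1
  ... | inj₂ 1≤0 = subst (0# ≤_) [-1]²≡1 (*-nonneg 0≤-1 0≤-1)
    where
    0≤-1 : 0# ≤ - 1#
    0≤-1 = subst₂ _≤_ (-‿inverseʳ 1#) (+-identityˡ (- 1#)) (+-monoˡ-≤ (- 1#) 1≤0)
    [-1]²≡1 : - 1# * - 1# ≡ 1#
    [-1]²≡1 = trans (Ring.-1*x≈-x (- 1#)) (Ring.-‿involutive 1#)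

  1≰0 : ¬ 1# ≤ 0#
  1≰0 1≤0 = 0≢1 (≤-antisym 0≤1 1≤0)

  ⁻¹-inverseʳ : ∀ {x} → 0# < x → x * x ⁻¹ ≡ 1#
  ⁻¹-inverseʳ {x} (_ , 0≢x) = *-inverseʳ x λ x≡0 → 0≢x (sym x≡0)

  0<⁻¹ : ∀ {x} → 0# < x → 0# < x ⁻¹
  0<⁻¹ {x} 0<x@(0≤x , _) = 0≤x⁻¹ , λ 0≡x⁻¹ → 0≢1 (trans (sym (zeroʳ x)) (trans (cong (x *_) 0≡x⁻¹) (⁻¹-inverseʳ 0<x)))
    where
    0≤x⁻¹ : 0# ≤ x ⁻¹
    0≤x⁻¹ with total 0# (x ⁻¹)
    ... | inj₁ p = p
    ... | inj₂ p = contradiction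
      (subst₂ _≤_ (trans (*-comm (x ⁻¹) x) (⁻¹-inverseʳ 0<x)) (zeroˡ x) (*-monoˡ-≤ 0≤x p)) 1≰0

  *-cancelʳ-≤ : ∀ {x y z} → 0# < z → x * z ≤ y * z → x ≤ y
  *-cancelʳ-≤ {x} {y} {z} 0<z xz≤yz =
    subst₂ _≤_ (z/z x) (z/z y) (*-monoˡ-≤ (proj₁ (0<⁻¹ 0<z)) xz≤yz)
    where
    z/z : ∀ w → w * z * z ⁻¹ ≡ w
    z/z w = trans (*-assoc w z (z ⁻¹)) (trans (cong (w *_) (⁻¹-inverseʳ 0<z)) (*-identityʳ w))

  x/y*y≡x : ∀ x {y} → 0# < y → x / y * y ≡ x
  x/y*y≡x x {y} 0<y = trans (*-assoc x (y ⁻¹) y)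
    (trans (cong (x *_) (trans (*-comm (y ⁻¹) y) (⁻¹-inverseʳ 0<y))) (*-identityʳ x))

  *-pos : ∀ {x y} → 0# < x → 0# < y → 0# < x * y
  *-pos {x} {y} (0≤x , 0≢x) 0<y@(0≤y , _) = *-nonneg 0≤x 0≤y , λ 0≡xy →
    0≢x (≤-antisym 0≤x (*-cancelʳ-≤ 0<y (≤-reflexive (trans (sym 0≡xy) (sym (zeroˡ y))))))

  fromℕ-+ : ∀ a b → fromℕ (a ℕ.+ b) ≡ fromℕ a + fromℕ b
  fromℕ-+ a b = Mult.×-homo-+ 1# a b

  fromℕ-* : ∀ a b → fromℕ (a ℕ.* b) ≡ fromℕ a * fromℕ b
  fromℕ-* = Mult.×1-homo-*

  fromℕ-^ : ∀ a k → fromℕ (a ℕ.^ k) ≡ fromℕ a ^ k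
  fromℕ-^ a zero    = +-identityʳ 1#
  fromℕ-^ a (suc k) = trans (fromℕ-* a (a ℕ.^ k)) (cong (fromℕ a *_) (fromℕ-^ a k))

  0≤fromℕ : ∀ a → 0# ≤ fromℕ a
  0≤fromℕ zero    = ≤-refl
  0≤fromℕ (suc a) = ≤-trans (0≤fromℕ a) (subst (_≤ 1# + fromℕ a) (+-identityˡ _) (+-monoˡ-≤ (fromℕ a) 0≤1))

  fromℕ-mono-≤ : ∀ {a b} → a ℕ.≤ b → fromℕ a ≤ fromℕ b
  fromℕ-mono-≤ {b = b} z≤n = 0≤fromℕ b
  fromℕ-mono-≤ (s≤s a≤b)   = +-mono-≤ ≤-refl (fromℕ-mono-≤ a≤b)

  fromℕ-cancel-≤ : ∀ {a b} → fromℕ a ≤ fromℕ b → a ℕ.≤ b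
  fromℕ-cancel-≤ {a} {b} p with a ℕ.≤? b
  ... | yes a≤b = a≤b
  ... | no  a≰b = contradiction (subst₂ _≤_ (1+x-x) (-‿inverseʳ (fromℕ b))
    (+-monoˡ-≤ (- fromℕ b) (≤-trans (fromℕ-mono-≤ (ℕ.≰⇒> a≰b)) p))) 1≰0
    where
    1+x-x : 1# + fromℕ b - fromℕ b ≡ 1#
    1+x-x = trans (+-assoc 1# _ _) (trans (cong (1# +_) (-‿inverseʳ (fromℕ b))) (+-identityʳ 1#))

  0<fromℕ : ∀ a .{{_ : ℕ.NonZero a}} → 0# < fromℕ a
  0<fromℕ (suc a) = 0≤fromℕ (suc a) , λ 0≡1+a →
    contradiction (fromℕ-cancel-≤ {suc a} {0} (≤-reflexive (sym 0≡1+a))) λ ()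

  ^-nonneg : ∀ {x} k → 0# ≤ x → 0# ≤ x ^ k
  ^-nonneg zero    0≤x = 0≤1
  ^-nonneg (suc k) 0≤x = *-nonneg 0≤x (^-nonneg k 0≤x)

  ^-monoˡ-≤ : ∀ {x y} k → 0# ≤ x → x ≤ y → x ^ k ≤ y ^ k
  ^-monoˡ-≤ zero    0≤x x≤y = ≤-refl
  ^-monoˡ-≤ (suc k) 0≤x x≤y =
    *-mono-≤ (≤-trans 0≤x x≤y) (^-nonneg k 0≤x) x≤y (^-monoˡ-≤ k 0≤x x≤y)

  x^2≡x*x : ∀ x → x ^ 2 ≡ x * x
  x^2≡x*x x = cong (x *_) (*-identityʳ x)

  -- A search downwards from n; positivity of y excludes the ceiling 0. Minimality converts farness
  -- by the real amount ε n into an integer threshold.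
  natural-ceiling : ExcludedMiddle 0ℓ → ∀ n {y} → 0# < y → y ≤ fromℕ n →
    ∃[ e ] fromℕ e ≤ y × y ≤ fromℕ (suc e) × suc e ℕ.≤ n × (∀ d → y ≤ fromℕ d → suc e ℕ.≤ d)
  natural-ceiling em zero    (0≤y , 0≢y) y≤0 = contradiction (≤-antisym 0≤y y≤0) 0≢y
  natural-ceiling em (suc n) {y} 0<y y≤1+n with em {y ≤ fromℕ n}
  ... | yes y≤n with e , e≤y , y≤1+e , e<n , least ← natural-ceiling em n 0<y y≤n
    = e , e≤y , y≤1+e , ℕ.≤-trans e<n (ℕ.n≤1+n n) , least
  ... | no  y≰n = n , n≤y , y≤1+n , ℕ.≤-refl , least
    where
    n≤y : fromℕ n ≤ y
    n≤y with total y (fromℕ n)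
    ... | inj₁ y≤n = contradiction y≤n y≰n
    ... | inj₂ n≤y = n≤y
    least : ∀ d → y ≤ fromℕ d → suc n ℕ.≤ d
    least d y≤d with suc n ℕ.≤? d
    ... | yes n<d = n<d
    ... | no  n≮d = contradiction (≤-trans y≤d (fromℕ-mono-≤ (ℕ.≤-pred (ℕ.≰⇒> n≮d)))) y≰n

  n≤2^n : ∀ n → n ℕ.≤ 2 ℕ.^ n
  n≤2^n zero    = z≤n
  n≤2^n (suc n) = ℕ.≤-trans (ℕ.+-mono-≤ (ℕ.m^n>0 2 n) (n≤2^n n))
    (ℕ.≤-reflexive (cong (2 ℕ.^ n ℕ.+_) (sym (ℕ.+-identityʳ (2 ℕ.^ n)))))

  2^-cancel-≤ : ∀ {a b} → fromℕ 2 ^ a ≤ fromℕ 2 ^ b → a ℕ.≤ b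
  2^-cancel-≤ {a} {b} p with a ℕ.≤? b
  ... | yes a≤b = a≤b
  ... | no  a≰b = contradiction
    (fromℕ-cancel-≤ (subst₂ _≤_ (sym (fromℕ-^ 2 a)) (sym (fromℕ-^ 2 b)) p))
    (ℕ.<⇒≱ (ℕ.^-monoʳ-< 2 (s≤s (s≤s z≤n)) (ℕ.≰⇒> a≰b)))

  -- Lower bounds on the logarithm

  module Logarithm (em : ExcludedMiddle 0ℓ) where
    open Log em R

    -- Completeness rules out the default value of `sup`.
    sup-upper : ∀ S → ∃ S → ∃ (IsUpperBound S) → IsUpperBound S (sup S)
    sup-upper S inhabited bounded with em {∃ (IsSupremum S)}
    ... | yes (_ , upper , _) = upper
    ... | no  ¬s = contradiction (complete S inhabited bounded) ¬s

    -- The number k is one of the rationals in the supremum, with a = k and b = q = 0. The set is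
    -- bounded by n because x ≤ n ≤ 2 ^ n, after comparing exponents of 2.
    k≤log₂ : ∀ {x} k n → 0# ≤ x → x ≤ fromℕ n → fromℕ 2 ^ k ≤ x → fromℕ k ≤ log₂ x
    k≤log₂ {x} k n 0≤x x≤n 2^k≤x = sup-upper S (fromℕ k , k∈S) (fromℕ n , n-bounds) (fromℕ k) k∈S
      where
      S : Pred ℝ 0ℓ
      S r = ∃[ a ] ∃[ b ] ∃[ q ] r ≡ (fromℕ a - fromℕ b) / fromℕ (suc q) ×
            fromℕ 2 ^ a ≤ fromℕ 2 ^ b * x ^ suc q

      k∈S : fromℕ k ∈ S
      k∈S = k , 0 , 0 , k≡ , ≤-trans 2^k≤x (≤-reflexive (sym (trans (*-identityˡ _) (*-identityʳ x))))
        where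
        k-0≡k : fromℕ k - 0# ≡ fromℕ k
        k-0≡k = trans (cong (_- 0#) (sym (+-identityˡ (fromℕ k)))) (trans (+-assoc 0# _ _) (x+[y-x]≡y 0# (fromℕ k)))
        k≡ : fromℕ k ≡ (fromℕ k - 0#) / fromℕ 1
        k≡ = begin-equality
          fromℕ k                        ≡⟨ x/y*y≡x (fromℕ k) (0<fromℕ 1) ⟨
          fromℕ k / fromℕ 1 * fromℕ 1    ≡⟨ cong (fromℕ k / fromℕ 1 *_) (+-identityʳ 1#) ⟩
          fromℕ k / fromℕ 1 * 1#         ≡⟨ *-identityʳ _ ⟩
          fromℕ k / fromℕ 1              ≡⟨ cong (_/ fromℕ 1) k-0≡k ⟨
          (fromℕ k - 0#) / fromℕ 1       ∎

      n-bounds : IsUpperBound S (fromℕ n)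
      n-bounds r (a , b , q , r≡ , 2^a≤) = *-cancelʳ-≤ (0<fromℕ (suc q)) (begin
        r * fromℕ (suc q)                       ≡⟨ trans (cong (_* fromℕ (suc q)) r≡) (x/y*y≡x _ (0<fromℕ (suc q))) ⟩
        fromℕ a - fromℕ b                       ≤⟨ +-monoˡ-≤ (- fromℕ b) (fromℕ-mono-≤ a≤) ⟩
        fromℕ (b ℕ.+ n ℕ.* suc q) - fromℕ b     ≡⟨ cong (_- fromℕ b) (fromℕ-+ b (n ℕ.* suc q)) ⟩
        fromℕ b + fromℕ (n ℕ.* suc q) - fromℕ b ≡⟨ +-assoc _ _ _ ⟩
        fromℕ b + (fromℕ (n ℕ.* suc q) - fromℕ b) ≡⟨ x+[y-x]≡y _ _ ⟩
        fromℕ (n ℕ.* suc q)                     ≡⟨ fromℕ-* n (suc q) ⟩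
        fromℕ n * fromℕ (suc q)                 ∎)
        where
        x≤2^n : x ≤ fromℕ 2 ^ n
        x≤2^n = begin
          x                 ≤⟨ x≤n ⟩
          fromℕ n           ≤⟨ fromℕ-mono-≤ (n≤2^n n) ⟩
          fromℕ (2 ℕ.^ n)   ≡⟨ fromℕ-^ 2 n ⟩
          fromℕ 2 ^ n       ∎
        a≤ : a ℕ.≤ b ℕ.+ n ℕ.* suc q
        a≤ = 2^-cancel-≤ (begin
          fromℕ 2 ^ a                            ≤⟨ 2^a≤ ⟩
          fromℕ 2 ^ b * x ^ suc q                ≤⟨ *-monoʳ-≤ (^-nonneg b (0≤fromℕ 2)) (^-monoˡ-≤ (suc q) 0≤x x≤2^n) ⟩
          fromℕ 2 ^ b * (fromℕ 2 ^ n) ^ suc q    ≡⟨ cong (fromℕ 2 ^ b *_) (Exp.^-assocʳ (fromℕ 2) n (suc q)) ⟩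
          fromℕ 2 ^ b * fromℕ 2 ^ (n ℕ.* suc q)  ≡⟨ Exp.^-homo-* (fromℕ 2) b (n ℕ.* suc q) ⟨
          fromℕ 2 ^ (b ℕ.+ n ℕ.* suc q)          ∎)

    1≤log⁺ : ∀ x → 1# ≤ log⁺ x
    1≤log⁺ x = Max.x≤x⊔y totalOrder 1# (log₂ x)

    -- One copy of `log⁺` pays for the 1, the other for k; its floor of 1 also covers k = 0 when x
    -- is small.
    1+k≤2log⁺ : ∀ {x} k n → 0# ≤ x → x ≤ fromℕ n → k ≡ 0 ⊎ fromℕ 2 ^ k ≤ x →
      fromℕ (suc k) ≤ fromℕ 2 * log⁺ x
    1+k≤2log⁺ {x} k n 0≤x x≤n cases = begin
      1# + fromℕ k        ≤⟨ +-mono-≤ (1≤log⁺ x) (k≤log⁺ cases) ⟩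
      log⁺ x + log⁺ x     ≡⟨ double ⟩
      fromℕ 2 * log⁺ x    ∎
      where
      k≤log⁺ : k ≡ 0 ⊎ fromℕ 2 ^ k ≤ x → fromℕ k ≤ log⁺ x
      k≤log⁺ (inj₁ refl)  = ≤-trans 0≤1 (1≤log⁺ x)
      k≤log⁺ (inj₂ 2^k≤x) = ≤-trans (k≤log₂ k n 0≤x x≤n 2^k≤x) (Max.x≤y⊔x totalOrder 1# (log₂ x))
      double : log⁺ x + log⁺ x ≡ fromℕ 2 * log⁺ x
      double = sym (trans (distribʳ (log⁺ x) 1# (1# + 0#)) (cong₂ _+_ (*-identityˡ _)
        (trans (cong (_* log⁺ x) (+-identityʳ 1#)) (*-identityˡ _))))

-- Rounding and the constants of the theorem

scale-bound : ∀ K {e} → 2 ℕ.* 2 ℕ.^ K ℕ.≤ suc (suc e) → K ≡ 0 ⊎ 2 ℕ.^ K ℕ.≤ e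
scale-bound zero        _  = inj₁ refl
-- Here 2 ≤ 2 ^ suc K absorbs the 2 in e + 2. The bound has to be e, since e + 1 may exceed ε n.
scale-bound (suc K) {e} lo = inj₂ (ℕ.+-cancelˡ-≤ 2 _ _ (begin
  2 ℕ.+ 2 ℕ.^ suc K             ≤⟨ ℕ.+-monoˡ-≤ (2 ℕ.^ suc K) (ℕ.*-monoʳ-≤ 2 (ℕ.m^n>0 2 K)) ⟩
  2 ℕ.^ suc K ℕ.+ 2 ℕ.^ suc K   ≡⟨ cong (2 ℕ.^ suc K ℕ.+_) (ℕ.+-identityʳ (2 ℕ.^ suc K)) ⟨
  2 ℕ.* 2 ℕ.^ suc K             ≤⟨ lo ⟩
  2 ℕ.+ e                       ∎))
  where open ℕ.≤-Reasoning

-- One more than the quotient: the number of batches stays positive, and the overshoot is at most y.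
round-up : ∀ x y .{{_ : NonZero y}} → ∃[ q ] x ℕ.≤ suc q ℕ.* y × suc q ℕ.* y ℕ.≤ y ℕ.+ x
round-up x y = x ℕ./ y
  , ℕ.≤-trans (ℕ.≤-reflexive (ℕ.m≡m%n+[m/n]*n x y)) (ℕ.+-monoˡ-≤ _ (ℕ.<⇒≤ (ℕ.m%n<n x y)))
  , ℕ.+-monoʳ-≤ y (ℕ.m/n*n≤m x y)

module Parameters (R : CompleteOrderedField) where
  open CompleteOrderedField R
  open OrderedField R

  -- With L = log⁺ (ε n), the tester makes at most A L / ε batches.
  A : ℝ
  A = fromℕ 41 * fromℕ 2

  0<A : 0# < A
  0<A = *-pos (0<fromℕ 41) (0<fromℕ 2)

  batches-bound : ∀ {ε L : ℝ} {m E k n} .{{_ : NonZero n}} → ε * fromℕ n ≤ fromℕ E →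
    m ℕ.* E ℕ.≤ 41 ℕ.* k ℕ.* n → fromℕ k ≤ fromℕ 2 * L → fromℕ m * ε ≤ A * L
  batches-bound {ε} {L} {m} {E} {k} {n} εn≤E mE≤ k≤2L = *-cancelʳ-≤ (0<fromℕ n) (begin
    fromℕ m * ε * fromℕ n             ≡⟨ *-assoc (fromℕ m) ε (fromℕ n) ⟩
    fromℕ m * (ε * fromℕ n)           ≤⟨ *-monoʳ-≤ (0≤fromℕ m) εn≤E ⟩
    fromℕ m * fromℕ E                 ≡⟨ fromℕ-* m E ⟨
    fromℕ (m ℕ.* E)                   ≤⟨ fromℕ-mono-≤ mE≤ ⟩
    fromℕ (41 ℕ.* k ℕ.* n)            ≡⟨ trans (fromℕ-* (41 ℕ.* k) n) (cong (_* fromℕ n) (fromℕ-* 41 k)) ⟩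
    fromℕ 41 * fromℕ k * fromℕ n      ≤⟨ *-monoˡ-≤ (0≤fromℕ n) (*-monoʳ-≤ (0≤fromℕ 41) k≤2L) ⟩
    fromℕ 41 * (fromℕ 2 * L) * fromℕ n ≡⟨ cong (_* fromℕ n) (*-assoc (fromℕ 41) (fromℕ 2) L) ⟨
    A * L * fromℕ n                   ∎)

  queries-bound : ∀ {ε L : ℝ} {m} → 0# < ε → fromℕ m * ε ≤ A * L →
    fromℕ (m ℕ.* 2) ≤ A * fromℕ 2 * (L / ε)
  queries-bound {ε} {L} {m} 0<ε mε≤AL = *-cancelʳ-≤ 0<ε (begin
    fromℕ (m ℕ.* 2) * ε              ≡⟨ cong (_* ε) (fromℕ-* m 2) ⟩
    fromℕ m * fromℕ 2 * ε            ≡⟨ solve 3 (λ m b e → m :* b :* e := m :* e :* b) refl (fromℕ m) (fromℕ 2) ε ⟩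
    fromℕ m * ε * fromℕ 2            ≤⟨ *-monoˡ-≤ (0≤fromℕ 2) mε≤AL ⟩
    A * L * fromℕ 2                  ≡⟨ solve 3 (λ a l b → a :* l :* b := a :* b :* l) refl A L (fromℕ 2) ⟩
    A * fromℕ 2 * L                  ≡⟨ cong (A * fromℕ 2 *_) (x/y*y≡x L 0<ε) ⟨
    A * fromℕ 2 * (L / ε * ε)        ≡⟨ *-assoc (A * fromℕ 2) (L / ε) ε ⟨
    A * fromℕ 2 * (L / ε) * ε        ∎)

  -- Chosen to cancel the factor 12 A² that arises in `budget-bound`.
  c : ℝ
  c = (fromℕ 12 * (A * A)) ⁻¹

  0<12A² : 0# < fromℕ 12 * (A * A)
  0<12A² = *-pos (0<fromℕ 12) (*-pos 0<A 0<A)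

  -- One factor m comes from the union bound over batches and one from the growth m t of the budget.
  -- After multiplication by ε² each becomes m ε ≤ A L, which is why t is limited by ε² n / L².
  budget-bound : ∀ {ε L t : ℝ} {m D n} → 0# < ε → 0# < L → 0# < t →
    t ≤ (c * ε ^ 2 * fromℕ n) / (L ^ 2) → fromℕ m * ε ≤ A * L → fromℕ D ≤ fromℕ m * t →
    12 ℕ.* m ℕ.* D ℕ.≤ n
  budget-bound {ε} {L} {t} {m} {D} {n} 0<ε 0<L (0≤t , _) t≤ mε≤AL D≤mt =
    fromℕ-cancel-≤ (*-cancelʳ-≤ (*-pos 0<ε 0<ε) (begin
      fromℕ (12 ℕ.* m ℕ.* D) * (ε * ε)
        ≡⟨ cong (_* (ε * ε)) (trans (fromℕ-* (12 ℕ.* m) D) (cong (_* fromℕ D) (fromℕ-* 12 m))) ⟩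
      fromℕ 12 * M * fromℕ D * (ε * ε)
        ≤⟨ *-monoˡ-≤ (*-nonneg 0≤ε 0≤ε) (*-monoʳ-≤ (*-nonneg (0≤fromℕ 12) (0≤fromℕ m)) D≤mt) ⟩
      fromℕ 12 * M * (M * t) * (ε * ε)
        ≡⟨ solve 4 (λ b m t e → b :* m :* (m :* t) :* (e :* e) := b :* t :* (m :* e :* (m :* e))) refl (fromℕ 12) M t ε ⟩
      fromℕ 12 * t * (M * ε * (M * ε))
        ≤⟨ *-monoʳ-≤ (*-nonneg (0≤fromℕ 12) 0≤t) (*-mono-≤ 0≤AL 0≤Mε mε≤AL mε≤AL) ⟩
      fromℕ 12 * t * (A * L * (A * L))
        ≡⟨ solve 4 (λ b t a l → b :* t :* (a :* l :* (a :* l)) := b :* (a :* a) :* (t :* (l :* l))) refl (fromℕ 12) t A L ⟩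
      fromℕ 12 * (A * A) * (t * (L * L))
        ≤⟨ *-monoʳ-≤ (proj₁ 0<12A²) tL²≤ ⟩
      fromℕ 12 * (A * A) * (c * (ε * ε) * fromℕ n)
        ≡⟨ solve 4 (λ a c e n → a :* (c :* e :* n) := a :* c :* (n :* e)) refl (fromℕ 12 * (A * A)) c (ε * ε) (fromℕ n) ⟩
      fromℕ 12 * (A * A) * c * (fromℕ n * (ε * ε))
        ≡⟨ cong (_* (fromℕ n * (ε * ε))) (⁻¹-inverseʳ 0<12A²) ⟩
      1# * (fromℕ n * (ε * ε))
        ≡⟨ *-identityˡ _ ⟩
      fromℕ n * (ε * ε) ∎))
    where
    M = fromℕ m
    0≤ε = proj₁ 0<ε
    0≤Mε = *-nonneg (0≤fromℕ m) 0≤ε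
    0≤AL = ≤-trans 0≤Mε mε≤AL
    tL²≤ : t * (L * L) ≤ c * (ε * ε) * fromℕ n
    tL²≤ = begin
      t * (L * L)
        ≡⟨ cong (t *_) (x^2≡x*x L) ⟨
      t * L ^ 2
        ≤⟨ *-monoˡ-≤ (^-nonneg 2 (proj₁ 0<L)) t≤ ⟩
      (c * ε ^ 2 * fromℕ n) / (L ^ 2) * L ^ 2
        ≡⟨ x/y*y≡x _ (subst (0# <_) (sym (x^2≡x*x L)) (*-pos 0<L 0<L)) ⟩
      c * ε ^ 2 * fromℕ n
        ≡⟨ cong (λ z → c * z * fromℕ n) (x^2≡x*x ε) ⟩
      c * (ε * ε) * fromℕ n ∎

-- Answers of an erasure oracle

module Erasures (em : ExcludedMiddle 0ℓ) (R : CompleteOrderedField) where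
  open Online em R

  erased : ∀ {n b t} {f : Seq n} {𝒪 : Adversary n b} → IsBudgetManaging erasure t f 𝒪 →
    ∀ h x → 𝒪 h x ≡ just (f x) ⊎ 𝒪 h x ≡ nothing
  erased 𝒪-ok []       x = inj₁ (IsBudgetManaging.initial 𝒪-ok x)
  erased 𝒪-ok (xs ∷ h) x with IsBudgetManaging.manipulates 𝒪-ok xs h x
  ... | inj₁ e = Sum.map (trans e) (trans e) (erased 𝒪-ok h x)
  ... | inj₂ e = inj₂ e

theorem1p5 : (em : ExcludedMiddle 0ℓ) (R : CompleteOrderedField) →
    let open CompleteOrderedField R
        open Log em R
        open Online em R
    in
    ∃[ c ] 0# < c × ∃[ C ] 0# < C ×
      (∀ (ε : ℝ) → 0# < ε → ε < 1# →
       ∀ (n : ℕ) → .{{_ : NonZero n}} →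
       ∀ (P : Pred (Seq n) 0ℓ) → IsLocal P →
       ∀ (t : ℝ) → 0# < t →
       t ≤ (c * ε ^ 2 * fromℕ n) / (log⁺ (ε * fromℕ n) ^ 2) →
       (Σ (Tester n 2) λ T →
          IsTester ε P erasure t T ×
          HasOneSidedError P erasure t T ×
          QueryComplexity≤ (C * (log⁺ (ε * fromℕ n) / ε)) T) ×
       (Σ (Tester n 2) λ T →
          IsTester ε P corruption t T ×
          QueryComplexity≤ (C * (log⁺ (ε * fromℕ n) / ε)) T))
-- The same tester serves both kinds of adversary.
theorem1p5 em R = c , 0<⁻¹ 0<12A² , A * fromℕ 2 , *-pos 0<A (0<fromℕ 2) ,
  λ ε 0<ε ε<1 n P local t 0<t t≤ →
    let T , isTester , oneSided , queries = construct ε 0<ε ε<1 n P local t 0<t t≤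
    in (T , isTester erasure , oneSided , queries) , (T , isTester corruption , queries)
  where
  open CompleteOrderedField R
  open OrderedField R
  open Logarithm em
  open Parameters R
  open Log em R
  open Online em R

  εn≤n : ∀ {ε} → ε < 1# → ∀ n → ε * fromℕ n ≤ fromℕ n
  εn≤n {ε} (ε≤1 , _) n = subst (ε * fromℕ n ≤_) (*-identityˡ (fromℕ n)) (*-monoˡ-≤ (0≤fromℕ n) ε≤1)

  -- The integer threshold is the ceiling e + 1 of ε n, the mesh 2 ^ K is of the same order, and m
  -- is about 40 (K + 1) n / (e + 1).
  construct : ∀ (ε : ℝ) → 0# < ε → ε < 1# → ∀ (n : ℕ) → .{{_ : NonZero n}} →
    ∀ (P : Pred (Seq n) 0ℓ) → IsLocal P → ∀ (t : ℝ) → 0# < t →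
    t ≤ (c * ε ^ 2 * fromℕ n) / (log⁺ (ε * fromℕ n) ^ 2) →
    Σ (Tester n 2) λ T → (∀ κ → IsTester ε P κ t T) × HasOneSidedError P erasure t T ×
      QueryComplexity≤ (A * fromℕ 2 * (log⁺ (ε * fromℕ n) / ε)) T
  construct ε 0<ε ε<1 n P local t 0<t t≤
    with e , e≤εn , εn≤E , E≤n , least ← natural-ceiling em n (*-pos 0<ε (0<fromℕ n)) (εn≤n ε<1 n)
    with K , lo , hi ← dyadic-scale e
    with m-1 , enough , not-too-many ← round-up (40 ℕ.* (suc K ℕ.* n)) (suc e)
    = tester m , isTester , oneSided , m ℕ.* 2 , queries-bound {m = m} 0<ε mε≤AL , run-makesAtMost m
    where
    open PairTester em R K P
    L = log⁺ (ε * fromℕ n)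
    m = suc m-1

    -- The overshoot of `round-up` is at most e + 1 ≤ n, which raises 40 to 41.
    mE≤ : m ℕ.* suc e ℕ.≤ 41 ℕ.* suc K ℕ.* n
    mE≤ = NR.begin
      m ℕ.* suc e                            NR.≤⟨ not-too-many ⟩
      suc e ℕ.+ 40 ℕ.* (suc K ℕ.* n)         NR.≤⟨ ℕ.+-monoˡ-≤ _ (ℕ.≤-trans E≤n (ℕ.m≤n*m n (suc K))) ⟩
      suc K ℕ.* n ℕ.+ 40 ℕ.* (suc K ℕ.* n)   NR.≡⟨ ℕ.*-assoc 41 (suc K) n ⟨
      41 ℕ.* suc K ℕ.* n                     NR.∎
      where module NR = ℕ.≤-Reasoning

    2^K≤εn : K ≡ 0 ⊎ fromℕ 2 ^ K ≤ ε * fromℕ n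
    2^K≤εn = Sum.map₂ (λ 2^K≤e → subst (_≤ ε * fromℕ n) (fromℕ-^ 2 K) (≤-trans (fromℕ-mono-≤ 2^K≤e) e≤εn))
      (scale-bound K lo)

    mε≤AL : fromℕ m * ε ≤ A * L
    mε≤AL = batches-bound {m = m} {E = suc e} {k = suc K} {n = n} εn≤E mE≤
      (1+k≤2log⁺ K n (proj₁ (*-pos 0<ε (0<fromℕ n))) (εn≤n ε<1 n) 2^K≤εn)

    0<L : 0# < L
    0<L = ≤-trans 0≤1 (1≤log⁺ _) , λ 0≡L → 1≰0 (subst (1# ≤_) (sym 0≡L) (1≤log⁺ _))

    budget : ∀ {κ f} {𝒪 : Adversary n 2} → IsBudgetManaging κ t f 𝒪 →
      ∀ h → length h ℕ.< m → 12 ℕ.* m ℕ.* Dist (𝒪 []) (𝒪 h) ℕ.≤ n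
    budget 𝒪-ok h h<m = budget-bound {m = m} 0<ε 0<L 0<t t≤ mε≤AL
      (≤-trans (IsBudgetManaging.budget 𝒪-ok h) (*-monoˡ-≤ (proj₁ 0<t) (fromℕ-mono-≤ (ℕ.<⇒≤ h<m))))

    isTester : ∀ κ → IsTester ε P κ t (tester m)
    isTester κ f 𝒪 𝒪-ok =
      accepts f 𝒪 (IsBudgetManaging.initial 𝒪-ok) {m} (budget 𝒪-ok) ,
      λ far → rejects f 𝒪 (IsBudgetManaging.initial 𝒪-ok) {m} (budget 𝒪-ok)
        (Locality.local-splice em R P local) lo hi E≤n enough (λ g g∈P → least _ (far g g∈P))

    oneSided : HasOneSidedError P erasure t (tester m)
    oneSided f 𝒪 𝒪-ok f∈P s =
      Analysis.always-accepts f 𝒪 (Erasures.erased em R 𝒪-ok) f∈P m s []
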